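{- Let $\mathfrak g$ be of orthogonal or symplectic type, let $J_a$ be the universal character of the irreducible $\mathfrak g$-representation of highest weight $a\omega_1$ ($J_0=1$, $J_a=0$ for $a<0$), and consider the family $h^{(r)}_a=J_{a+r}+J_{a-r}$ for $r>0$, $h^{(r)}_a=J_{a+r}$ for $r\le0$, with associated basis $s_\lambda=\chi_{\mathfrak g}(\lambda)$ and associated operators $\psi_k,\psi_k^*,D_p,D^{(p)}$. Then for every $m\in\mathbb Z$ the generating functions $\Psi(u,m)=\sum_{k\in\mathbb Z}\psi_k|_{\mathcal B^{(m)}}u^k$ and $\Psi^*(u,m)=\sum_{k\in\mathbb Z}\psi^*_k|_{\mathcal B^{(m)}}u^{ -k}$ are given by $$\Psi(u,m)=u^{m+1}z\,J(u)\,\bigl(DE(-u)+DE(-1/u)-D_0\bigr),$$ $$\Psi^*(u,m)=u^{ -m+1}z^{ -1}J(u)^{ -1}\bigl(DH(u)-DH(1/u)\bigr),$$ where $J(u)=\sum_{s\in\mathbb Z}J_su^s$, $DE(u)=\sum_{p\in\mathbb Z}D_pu^p$ and $DH(u)=\sum_{p\in\mathbb Z}D^{(p)}u^p$.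
   Context: Let $B$ be the ring of symmetric functions over $\mathbb C$ with complete symmetric functions $h_k$ ($h_0=1$, $h_k=0$ for $k<0$). The universal character $J_a$ ($a>0$) of highest weight $a\omega_1$ ($\omega_1$ the first fundamental weight) is $J_a=h_a$ in the symplectic case and $J_a=h_a-h_{a-2}$ in the orthogonal case; $J_0=1$, $J_a=0$ for $a<0$. In either case $B=\mathbb C[J_1,J_2,\dots]$ is a polynomial ring in the $J_a$, $a\ge 1$. With $$h^{(r)}_a=\begin{cases}J_{a+r}+J_{a-r},& r>0,\\ J_{a+r},& r\le0,\end{cases}$$ the universal character $\chi_{\mathfrak g}(\lambda)$ of the irreducible representation with highest weight given by the partition $\lambda=(\lambda_1\ge\dots\ge\lambda_r>0)$ is (known Jacobi–Trudi identity) $\chi_{\mathfrak g}(\lambda)=\det[h^{(j-1)}_{\lambda_i-i+1}]_{1\le i,j\le r}$, and the $\chi_{\mathfrak g}(\lambda)$, over all partitions $\lambda$, form a linear basis of $B$. For any integer vector $\lambda=(\lambda_1,\dots,\lambda_l)$ (parts may be negative and in any order), extended by $\lambda_i=0$ for $i>l$, let $s_\lambda$ be the stable value, for large $N$, of $\det[h^{(j-1)}_{\lambda_i-i+1}]_{1\le i,j\le N}$ (the same for all $N\ge l$); for partitions $s_\lambda=\chi_{\mathfrak g}(\lambda)$. Let $z$ be a variable, $\mathcal B^{(m)}=z^mB$, $\mathcal B=\bigoplus_{m\in\mathbb Z}\mathcal B^{(m)}=B[z,z^{ -1}]$. Linear operators $\psi_k,\psi_k^*$ ($k\in\mathbb Z$)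 on $\mathcal B$ are defined on the basis $\{s_\lambda z^m\}$ ($\lambda$ a partition, $m\in\mathbb Z$) by $$\psi_k(s_\lambda z^m)=s_{(k-m-1,\lambda_1,\lambda_2,\dots)}z^{m+1},$$ $$\psi^*_k(s_\lambda z^m)=\sum_{t=1}^\infty(-1)^{t+1}\delta_{k-m-1,\,\lambda_t-t}\;s_{(\lambda_1+1,\dots,\lambda_{t-1}+1,\lambda_{t+1},\lambda_{t+2},\dots)}z^{m-1}.$$ Linear operators $D_p$ and $D^{(p)}$ ($p\in\mathbb Z$) on $B$ are defined on $s_\lambda$, $\lambda=(\lambda_1\ge\dots\ge\lambda_l\ge0)$ a partition, by $$D_p(s_\lambda)=\det\left[h^{(j)}_{\lambda_i-i}\right]_{i=1,\dots,l;\;j=0,1,\dots,\widehat p,\dots,l}\ \text{ if }0\le p\le l,\qquad D_p(s_\lambda)=0\ \text{ otherwise}$$ (the column $j=p$ is omitted), and $$D^{(p)}(s_\lambda)=\sum_{t=1}^\infty(-1)^{t+1}h^{(p)}_{\lambda_t-t+2}\,s_{(\lambda_1+1,\dots,\lambda_{t-1}+1,\lambda_{t+1},\lambda_{t+2},\dots)},$$ where $\lambda_t=0$ for $t>l$ (a finite sum). They are extended to $\mathcal B$ by commuting with $z^{\pm1}$. For each fixed element of $B$ only finitely many $D_p$ and finitely many $D^{(p)}$ are nonzero on it ($D_p=0$ for $p<0$, $D^{(p)}=0$ for $p\ge0$, $D^{(p)}(s_\lambda)=0$ for $-p>\lambda_1+1$). The elements $J_s$ act by multiplication, after the operators $D_p,D^{(p)}$;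 $J(u)^{ -1}$ is the inverse formal power series in $u$. The identities are identities of formal series in $u^{\pm1}$ with coefficients operators from $\mathcal B^{(m)}$ to $\mathcal B^{(m\pm1)}$. -}

module Defs where

open import Algebra.Bundles using (CommutativeMonoid; AbelianGroup; Ring; CommutativeRing)
open import Algebra.Module.Bundles using (LeftModule)
open import Algebra.Module.Morphism.Structures using (module LeftModuleMorphisms)
import Algebra.Properties.Monoid.Sum as Sum
import Algebra.Properties.Ring as RingProperties
open import Data.Bool.Base using (if_then_else_)
open import Data.Fin.Base using (Fin; zero; suc; toℕ; punchIn)
open import Data.Integer.Base as ℤ using (ℤ; +_; -[1+_]; ∣_∣; 0ℤ; 1ℤ)
import Data.Integer.Properties as ℤ
open import Data.List.Base using (List; []; _∷_; _++_; length; map; drop; applyUpTo)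
open import Data.List.Relation.Unary.Linked using (Linked)
open import Data.Nat.Base as ℕ using (ℕ; zero; suc; _⊔_)
import Data.Nat.Properties as ℕ
open import Data.Product.Base using (∃-syntax; _×_; _,_; proj₁; proj₂)
open import Data.Sum.Base using (_⊎_)
import Level
open import Relation.Binary.PropositionalEquality as ≡ using (_≡_)
open import Relation.Nullary using (yes; no; does)
open import Relation.Nullary.Negation using (contradiction)

module FiniteSum {a ℓ} (M : CommutativeMonoid a ℓ) where
  open CommutativeMonoid M
  open Sum monoid using (sum-syntax)

  HasSumℕ : (ℕ → Carrier) → Carrier → Set ℓ
  HasSumℕ f x = ∃[ N ] (∀ t → N ℕ.≤ t → f t ≈ ε)
                     × (∑[ t < N ] f (toℕ t)) ≈ x

  -- Terms of index ≥ N in absolute value vanish, so the sum runs over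
  -- -N, …, N - 1.
  HasSumℤ : (ℤ → Carrier) → Carrier → Set ℓ
  HasSumℤ f x = ∃[ N ] (∀ s → N ℕ.≤ ∣ s ∣ → f s ≈ ε)
                     × (∑[ t < N ] f (+ toℕ t)) ∙ (∑[ t < N ] f -[1+ toℕ t ]) ≈ x

module Alternating {a ℓ} (A : AbelianGroup a ℓ) where
  open AbelianGroup A

  infixr 7 [-1]^_·_

  [-1]^_·_ : ℕ → Carrier → Carrier
  [-1]^ zero  · x = x
  [-1]^ suc n · x = ([-1]^ n · x) ⁻¹

------------------------------------------------------------------------

module Determinant {r ℓ} (R : CommutativeRing r ℓ) where
  open CommutativeRing R hiding (zero)
  open Sum +-monoid using (sum-syntax)
  open Alternating +-abelianGroup

  det : ∀ {n} → (Fin n → Fin n → Carrier) → Carrier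
  det {zero}  M = 1#
  det {suc n} M =
    ∑[ k < suc n ] ([-1]^ toℕ k · (M zero k * det (λ i j → M (suc i) (punchIn k j))))

------------------------------------------------------------------------

record LinearMap {r ℓr m ℓm} {R : Ring r ℓr} (M N : LeftModule R m ℓm)
       : Set (r Level.⊔ m Level.⊔ ℓm) where
  private
    module M = LeftModule M
    module N = LeftModule N
  open LeftModuleMorphisms M.rawLeftModule N.rawLeftModule
  infixr 9 _⟨$⟩_
  field
    _⟨$⟩_ : M.Carrierᴹ → N.Carrierᴹ
    isLeftModuleHomomorphism : IsLeftModuleHomomorphism _⟨$⟩_
  open IsLeftModuleHomomorphism isLeftModuleHomomorphism public

open LinearMap public using (_⟨$⟩_)

End : ∀ {r ℓr m ℓm} {R : Ring r ℓr} → LeftModule R m ℓm → Set (r Level.⊔ m Level.⊔ ℓm)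
End M = LinearMap M M

private
  ∣n∣≤∣n-e∣+∣e∣ : ∀ n e → ∣ n ∣ ℕ.≤ ∣ n ℤ.- e ∣ ℕ.+ ∣ e ∣
  ∣n∣≤∣n-e∣+∣e∣ n e =
    ≡.subst (λ k → ∣ k ∣ ℕ.≤ ∣ n ℤ.- e ∣ ℕ.+ ∣ e ∣) n-e+e≡n (ℤ.∣i+j∣≤∣i∣+∣j∣ (n ℤ.- e) e)
    where
    n-e+e≡n : n ℤ.- e ℤ.+ e ≡ n
    n-e+e≡n = ≡.trans (ℤ.+-assoc n (ℤ.- e) e)
                (≡.trans (≡.cong (λ k → n ℤ.+ k) (ℤ.+-inverseˡ e)) (ℤ.+-identityʳ n))

------------------------------------------------------------------------
-- The ring of symmetric functions over K is the polynomial ring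
-- K[h₁, h₂, …]: the free commutative K-algebra on the symbols h₁, h₂, …,
-- presented as terms modulo the congruence generated by the axioms of
-- commutative K-algebras.

module SymmetricFunctions {c ℓ} (K : CommutativeRing c ℓ) where
  private module K = CommutativeRing K

  infix  8 -_
  infixl 7 _*_
  infixl 6 _+_
  infix  4 _≈_

  data B : Set c where
    con     : K.Carrier → B
    h₁₊_    : ℕ → B                -- h₁₊ n is h_{n+1}
    _+_ _*_ : B → B → B
    -_      : B → B

  data _≈_ : B → B → Set (c Level.⊔ ℓ) where
    refl  : ∀ {x} → x ≈ x
    sym   : ∀ {x y} → x ≈ y → y ≈ x
    trans : ∀ {x y z} → x ≈ y → y ≈ z → x ≈ z

    con-cong : ∀ {a b} → a K.≈ b → con a ≈ con b
    +-cong   : ∀ {x x′ y y′} → x ≈ x′ → y ≈ y′ → x + y ≈ x′ + y′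
    *-cong   : ∀ {x x′ y y′} → x ≈ x′ → y ≈ y′ → x * y ≈ x′ * y′
    -‿cong   : ∀ {x x′} → x ≈ x′ → - x ≈ - x′

    +-homo : ∀ a b → con (a K.+ b) ≈ con a + con b
    *-homo : ∀ a b → con (a K.* b) ≈ con a * con b

    +-assoc     : ∀ x y z → (x + y) + z ≈ x + (y + z)
    +-comm      : ∀ x y → x + y ≈ y + x
    +-identityˡ : ∀ x → con K.0# + x ≈ x
    -‿inverseˡ  : ∀ x → - x + x ≈ con K.0#
    *-assoc     : ∀ x y z → (x * y) * z ≈ x * (y * z)
    *-comm      : ∀ x y → x * y ≈ y * x
    *-identityˡ : ∀ x → con K.1# * x ≈ x
    distribʳ    : ∀ x y z → (y + z) * x ≈ y * x + z * x

  B-ring : CommutativeRing c (c Level.⊔ ℓ)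
  B-ring = record
    { Carrier = B ; _≈_ = _≈_ ; _+_ = _+_ ; _*_ = _*_ ; -_ = -_
    ; 0# = con K.0# ; 1# = con K.1#
    ; isCommutativeRing = record
      { isRing = record
        { +-isAbelianGroup = record
          { isGroup = record
            { isMonoid = record
              { isSemigroup = record
                { isMagma = record
                  { isEquivalence = record { refl = refl ; sym = sym ; trans = trans }
                  ; ∙-cong = +-cong }
                ; assoc = +-assoc }
              ; identity = +-identityˡ , λ x → trans (+-comm _ _) (+-identityˡ x) }
            ; inverse = -‿inverseˡ , λ x → trans (+-comm _ _) (-‿inverseˡ x)
            ; ⁻¹-cong = -‿cong }
          ; comm = +-comm }
        ; *-cong = *-cong
        ; *-assoc = *-assoc
        ; *-identity = *-identityˡ , λ x → trans (*-comm _ _) (*-identityˡ x)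
        ; distrib = (λ x y z → trans (*-comm _ _) (trans (distribʳ x y z)
                                 (+-cong (*-comm _ _) (*-comm _ _))))
                  , distribʳ }
      ; *-comm = *-comm } }

  open CommutativeRing B-ring public using (0#; 1#; _-_; +-abelianGroup)

  private
    module R = CommutativeRing B-ring

  B-module : LeftModule K.ring c (c Level.⊔ ℓ)
  B-module = record
    { Carrierᴹ = B ; _≈ᴹ_ = _≈_ ; _+ᴹ_ = _+_ ; _*ₗ_ = λ a x → con a * x
    ; 0ᴹ = 0# ; -ᴹ_ = -_
    ; isLeftModule = record
      { isLeftSemimodule = record
        { +ᴹ-isCommutativeMonoid = R.+-isCommutativeMonoid
        ; isPreleftSemimodule = record
          { *ₗ-cong = λ a x → *-cong (con-cong a) x
          ; *ₗ-zeroˡ = R.zeroˡ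
          ; *ₗ-distribʳ = λ x a b → trans (*-cong (+-homo a b) refl) (distribʳ x _ _)
          ; *ₗ-identityˡ = *-identityˡ
          ; *ₗ-assoc = λ a b x → trans (*-cong (*-homo a b) refl) (*-assoc _ _ _)
          ; *ₗ-zeroʳ = λ a → R.zeroʳ (con a)
          ; *ₗ-distribˡ = λ a → R.distribˡ (con a) } }
      ; -ᴹ‿cong = -‿cong
      ; -ᴹ‿inverse = R.-‿inverse } }

  h : ℤ → B
  h (+ zero)  = 1#
  h (+ suc n) = h₁₊ n
  h -[1+ n ]  = 0#

  ----------------------------------------------------------------------

  -- ⨁ₘ zᵐ B: families (coeff n)ₙ, where coeff n is the coefficient of zⁿ.
  record 𝓑 : Set (c Level.⊔ ℓ) where
    field
      coeff  : ℤ → B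
      bound  : ℕ
      finite : ∀ n → bound ℕ.< ∣ n ∣ → coeff n ≈ 0#
  open 𝓑 public

  infix 4 _≋_

  -- The bound is irrelevant for equality.
  _≋_ : 𝓑 → 𝓑 → Set (c Level.⊔ ℓ)
  v ≋ w = ∀ n → coeff v n ≈ coeff w n

  private
    open RingProperties R.ring using (-0#≈0#)

    add : 𝓑 → 𝓑 → 𝓑
    add v w = record
      { coeff = λ n → coeff v n + coeff w n
      ; bound = bound v ⊔ bound w
      ; finite = λ n b<n → trans
          (+-cong (finite v n (ℕ.≤-<-trans (ℕ.m≤m⊔n _ _) b<n))
                  (finite w n (ℕ.≤-<-trans (ℕ.m≤n⊔m (bound v) _) b<n)))
          (+-identityˡ 0#) }

    neg : 𝓑 → 𝓑
    neg v = record
      { coeff = λ n → - coeff v n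
      ; bound = bound v
      ; finite = λ n b<n → trans (-‿cong (finite v n b<n)) -0#≈0# }

    nought : 𝓑
    nought = record { coeff = λ _ → 0# ; bound = 0 ; finite = λ _ _ → refl }

  infixr 7 _•_

  _•_ : B → 𝓑 → 𝓑
  b • v = record
    { coeff = λ n → b * coeff v n
    ; bound = bound v
    ; finite = λ n b<n → trans (*-cong refl (finite v n b<n)) (R.zeroʳ b) }

  𝓑-module : LeftModule K.ring (c Level.⊔ ℓ) (c Level.⊔ ℓ)
  𝓑-module = record
    { Carrierᴹ = 𝓑 ; _≈ᴹ_ = _≋_ ; _+ᴹ_ = add ; _*ₗ_ = λ a v → con a • v
    ; 0ᴹ = nought ; -ᴹ_ = neg
    ; isLeftModule = record
      { isLeftSemimodule = record
        { +ᴹ-isCommutativeMonoid = record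
          { isMonoid = record
            { isSemigroup = record
              { isMagma = record
                { isEquivalence = record
                  { refl = λ _ → refl
                  ; sym = λ p n → sym (p n)
                  ; trans = λ p q n → trans (p n) (q n) }
                ; ∙-cong = λ p q n → +-cong (p n) (q n) }
              ; assoc = λ u v w n → +-assoc _ _ _ }
            ; identity = (λ v n → +-identityˡ _) , (λ v n → R.+-identityʳ _) }
          ; comm = λ v w n → +-comm _ _ }
        ; isPreleftSemimodule = record
          { *ₗ-cong = λ a p n → M.*ₗ-cong a (p n)
          ; *ₗ-zeroˡ = λ v n → M.*ₗ-zeroˡ _
          ; *ₗ-distribʳ = λ v a b n → M.*ₗ-distribʳ _ a b
          ; *ₗ-identityˡ = λ v n → M.*ₗ-identityˡ _
          ; *ₗ-assoc = λ a b v n → M.*ₗ-assoc a b _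
          ; *ₗ-zeroʳ = λ a n → M.*ₗ-zeroʳ a
          ; *ₗ-distribˡ = λ a v w n → M.*ₗ-distribˡ a _ _ } }
      ; -ᴹ‿cong = λ p n → -‿cong (p n)
      ; -ᴹ‿inverse = (λ v n → -‿inverseˡ _) , (λ v n → R.-‿inverseʳ _) } }
    where module M = LeftModule B-module

  infixl 8 _z^_

  _z^_ : B → ℤ → 𝓑
  b z^ m = record
    { coeff = λ n → if does (n ℤ.≟ m) then b else 0#
    ; bound = ∣ m ∣
    ; finite = vanishes }
    where
    vanishes : ∀ n → ∣ m ∣ ℕ.< ∣ n ∣ → (if does (n ℤ.≟ m) then b else 0#) ≈ 0#
    vanishes n m<n with n ℤ.≟ m
    ... | yes n≡m = contradiction (≡.cong ∣_∣ (≡.sym n≡m)) (ℕ.<⇒≢ m<n)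
    ... | no  _   = refl

  infixr 8 z^_·_

  z^_·_ : ℤ → 𝓑 → 𝓑
  z^ e · v = record
    { coeff = λ n → coeff v (n ℤ.- e)
    ; bound = bound v ℕ.+ ∣ e ∣
    ; finite = λ n b<n → finite v (n ℤ.- e)
        (ℕ.+-cancelʳ-< ∣ e ∣ _ _ (ℕ.<-≤-trans b<n (∣n∣≤∣n-e∣+∣e∣ n e))) }

  -- The extension of an operator on B that commutes with z and z⁻¹.
  extend : End B-module → 𝓑 → 𝓑
  extend f v = record
    { coeff = λ n → f ⟨$⟩ coeff v n
    ; bound = bound v
    ; finite = λ n b<n → trans (LinearMap.⟦⟧-cong f (finite v n b<n)) (LinearMap.0ᴹ-homo f) }

  ----------------------------------------------------------------------
  -- Formal series in u^{±1} whose coefficients are operators on 𝓑;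
  -- F k is the coefficient of uᵏ.

  OpSeries : Set (c Level.⊔ ℓ)
  OpSeries = ℤ → 𝓑 → 𝓑

  private module M = LeftModule 𝓑-module

  infixl 6 _⊕_ _⊖_
  infixr 7 u^_z^_·_
  infix  4 _≐_∗_on-z^_B

  _⊕_ _⊖_ : OpSeries → OpSeries → OpSeries
  (F ⊕ G) k v = F k v M.+ᴹ G k v
  (F ⊖ G) k v = F k v M.+ᴹ M.-ᴹ G k v

  constant : (𝓑 → 𝓑) → OpSeries
  constant T k v = if does (k ℤ.≟ 0ℤ) then T v else M.0ᴹ

  multiplication : (ℤ → B) → OpSeries
  multiplication f k v = f k • v

  u^_z^_·_ : ℤ → ℤ → OpSeries → OpSeries
  (u^ a z^ e · F) k v = z^ e · F (k ℤ.- a) v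

  _[-u] _[1/u] : OpSeries → OpSeries
  (F [-u]) k v = [-1]^ ∣ k ∣ · F k v
    where open Alternating M.+ᴹ-abelianGroup
  (F [1/u]) k = F (ℤ.- k)

  -- G = A F as operators on 𝓑⁽ᵐ⁾: on every element of zᵐ B, each coefficient
  -- of the product is a sum with finitely many nonzero terms, equal to the
  -- corresponding coefficient of G.
  _≐_∗_on-z^_B : OpSeries → OpSeries → OpSeries → ℤ → Set (c Level.⊔ ℓ)
  G ≐ A ∗ F on-z^ m B =
    ∀ k b → HasSumℤ (λ s → A s (F (k ℤ.- s) (b z^ m))) (G k (b z^ m))
    where open FiniteSum M.+ᴹ-commutativeMonoid

------------------------------------------------------------------------
-- Integer vectors are lists, read as extended by zeros; a partition may
-- have trailing zero parts.  Parts are indexed from 0.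

part : List ℤ → ℕ → ℤ
part []      _       = 0ℤ
part (a ∷ α) zero    = a
part (a ∷ α) (suc i) = part α i

-- (λ₁+1, …, λ_{t-1}+1, λ_{t+1}, …) where the 1-based t is `suc i`.
remove : ℕ → List ℤ → List ℤ
remove i α = applyUpTo (λ j → part α j ℤ.+ 1ℤ) i ++ drop (suc i) α

IsPartition : List ℕ → Set
IsPartition = Linked ℕ._≥_

⌜_⌝ : List ℕ → List ℤ
⌜_⌝ = map +_

data LieType : Set where
  orthogonal symplectic : LieType

module FockSpace {c ℓ} (K : CommutativeRing c ℓ) (𝔤 : LieType) where
  open SymmetricFunctions K public
  open Determinant B-ring
  open Alternating +-abelianGroup
  private
    module R = CommutativeRing B-ring
    module M = LeftModule 𝓑-module

  J₊ : LieType → ℕ → B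
  J₊ symplectic a = h (+ a)
  J₊ orthogonal a = h (+ a) - h (+ a ℤ.- + 2)

  J : ℤ → B
  J (+ zero)  = 1#
  J (+ suc n) = J₊ 𝔤 (suc n)
  J -[1+ n ]  = 0#

  -- h⟨ r ⟩ a is h^{(r)}_a.
  h⟨_⟩ : ℤ → ℤ → B
  h⟨ + suc r ⟩ a = J (a ℤ.+ + suc r) + J (a ℤ.- + suc r)
  h⟨ + zero ⟩  a = J (a ℤ.+ 0ℤ)
  h⟨ -[1+ r ] ⟩ a = J (a ℤ.+ -[1+ r ])

  jacobiTrudi : ℕ → List ℤ → B
  jacobiTrudi N α = det {N} λ i j → h⟨ + toℕ j ⟩ (part α (toℕ i) ℤ.- + toℕ i)

  -- jacobiTrudi N α is the same for all N ≥ length α: the rows added by the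
  -- zero parts are lower unitriangular.
  s : List ℤ → B
  s α = jacobiTrudi (length α) α

  δ : ℤ → ℤ → B
  δ a b = if does (a ℤ.≟ b) then 1# else 0#

  ----------------------------------------------------------------------
  -- The linear operators, characterised by their values on the bases
  -- (s_λ zᵐ) of 𝓑 and (s_λ) of B

  module _ where
    open FiniteSum M.+ᴹ-commutativeMonoid

    IsCreation : (ℤ → End 𝓑-module) → Set (c Level.⊔ ℓ)
    IsCreation ψ = ∀ k m α → IsPartition α →
      ψ k ⟨$⟩ (s ⌜ α ⌝ z^ m) ≋ s ((k ℤ.- m ℤ.- 1ℤ) ∷ ⌜ α ⌝) z^ (m ℤ.+ 1ℤ)

    IsAnnihilation : (ℤ → End 𝓑-module) → Set (c Level.⊔ ℓ)
    IsAnnihilation ψ* = ∀ k m α → IsPartition α →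
      HasSumℕ
        (λ i → ([-1]^ i · (δ (k ℤ.- m ℤ.- 1ℤ) (part ⌜ α ⌝ i ℤ.- + suc i)
                            * s (remove i ⌜ α ⌝))) z^ (m ℤ.- 1ℤ))
        (ψ* k ⟨$⟩ (s ⌜ α ⌝ z^ m))

  -- The family D_p; punchIn p enumerates 0, …, p̂, …, l.
  record IsLowerD (D : ℤ → End B-module) : Set (c Level.⊔ ℓ) where
    field
      minor : ∀ α → IsPartition α → (p : Fin (suc (length α))) →
        D (+ toℕ p) ⟨$⟩ s ⌜ α ⌝
          ≈ det {length α} (λ i j → h⟨ + toℕ (punchIn p j) ⟩
                                      (part ⌜ α ⌝ (toℕ i) ℤ.- + suc (toℕ i)))
      outside : ∀ α → IsPartition α → ∀ p → p ℤ.< 0ℤ ⊎ + length α ℤ.< p →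
        D p ⟨$⟩ s ⌜ α ⌝ ≈ 0#

  -- The family D^{(p)}; λ_t - t + 2 is λ_t - i + 1 for t = suc i.
  IsUpperD : (ℤ → End B-module) → Set (c Level.⊔ ℓ)
  IsUpperD D = ∀ p α → IsPartition α →
    HasSumℕ
      (λ i → [-1]^ i · (h⟨ p ⟩ (part ⌜ α ⌝ i ℤ.- + i ℤ.+ 1ℤ) * s (remove i ⌜ α ⌝)))
      (D p ⟨$⟩ s ⌜ α ⌝)
    where open FiniteSum R.+-commutativeMonoid

  ----------------------------------------------------------------------

  -- convolve i (x₀ ∷ x₁ ∷ …) = J_i x₀ + J_{i+1} x₁ + …
  convolve : ℕ → List B → B
  convolve i []       = 0#
  convolve i (x ∷ xs) = J (+ i) * x + convolve (suc i) xs

  -- The coefficients of u⁰, …, uⁿ in J(u)⁻¹, in decreasing order.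
  inverseUpTo : ℕ → B × List B
  inverseUpTo zero    = 1# , []
  inverseUpTo (suc n) = let (x , xs) = inverseUpTo n in
    - convolve 1 (x ∷ xs) , x ∷ xs

  J⁻¹ : ℤ → B
  J⁻¹ (+ n)    = proj₁ (inverseUpTo n)
  J⁻¹ -[1+ n ] = 0#

  -- J(u) J(u)⁻¹ = 1
  J∗J⁻¹-zero : J 0ℤ * J⁻¹ 0ℤ ≈ 1#
  J∗J⁻¹-zero = R.*-identityˡ 1#

  J∗J⁻¹-suc : ∀ n → let (x , xs) = inverseUpTo (suc n) in convolve 0 (x ∷ xs) ≈ 0#
  J∗J⁻¹-suc n = trans (+-cong (*-identityˡ _) refl) (-‿inverseˡ _)

  ----------------------------------------------------------------------

  J[u] J⁻¹[u] : OpSeries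
  J[u]   = multiplication J
  J⁻¹[u] = multiplication J⁻¹

  Ψ[u] Ψ*[u] : (ℤ → End 𝓑-module) → OpSeries
  Ψ[u]  ψ  k = ψ k ⟨$⟩_
  Ψ*[u] ψ* k = ψ* (ℤ.- k) ⟨$⟩_

  D[u] : (ℤ → End B-module) → OpSeries
  D[u] D p = extend (D p)

-- On a basis element the creation formula is the expansion of the determinant
-- s_(n,λ) along its first row.  For the annihilation formula, D^{(p)} s_λ with
-- p ≥ 0 is the expansion of a determinant with two equal columns, so that
-- D^{(k)} - D^{(-k)} takes s_λ to Σ_t (-1)^{t+1} J_{λ_t-t+2+k} s_(…) for every k,
-- and multiplication by J(u)⁻¹ leaves one term δ for each t.
--
-- Linearity extends both from the s_λ to B because the s_λ span B.  For this,
-- J_n s_λ is written in terms of the s_μ by induction on |λ|: if n ≥ λ₁, expand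
-- s_(n,λ) along its first row, whose leading term is J_n s_λ up to terms with a
-- second factor of smaller degree; if n < λ₁, expand s_λ along its first row
-- and regard J_{λ₁±p} as the first factor instead.

module Submission where

open import Defs
open import Algebra.Bundles using (AbelianGroup; CommutativeMonoid; CommutativeRing)
open import Algebra.Module.Bundles using (LeftModule)
import Algebra.Properties.AbelianGroup as AbelianGroupProperties
import Algebra.Properties.CommutativeMonoid.Sum as MonoidSum
import Algebra.Properties.CommutativeSemigroup as CommutativeSemigroupProperties
import Algebra.Properties.Ring as RingProperties
import Algebra.Properties.Semiring.Sum as SemiringSum
import Algebra.Solver.CommutativeMonoid as MonoidSolver
open import Data.Bool.Base using (true; false; if_then_else_)
open import Data.Empty using (⊥-elim)
open import Data.Fin.Base using (Fin; zero; suc; toℕ; fromℕ; fromℕ<; inject₁; pinch; punchIn)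
open import Data.Fin.Properties using (toℕ<n; toℕ-fromℕ; toℕ-fromℕ<; toℕ-inject₁)
open import Data.Integer.Base as ℤ using (ℤ; +_; -[1+_]; ∣_∣; 0ℤ; 1ℤ; -1ℤ)
import Data.Integer.Properties as ℤ
open import Data.Integer.Tactic.RingSolver using (solve-∀)
open import Data.List.Base using (List; []; _∷_; applyUpTo; drop; length)
open import Data.List.Properties using (length-++; length-applyUpTo; length-drop; length-map)
open import Data.List.Relation.Unary.Linked using ([]; [-]; _∷_)
open import Data.Nat.Base as ℕ using (ℕ; zero; suc; _⊔_; z≤n; s≤s)
open import Data.Nat.ListAction using () renaming (sum to sumℕ)
import Data.Nat.Properties as ℕ
open import Data.Product.Base using (_×_; _,_; proj₁; proj₂)
open import Data.Sum.Base using (inj₁; inj₂)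
open import Function.Base using (_∘_)
open import Function.Bundles using (mk⇔)
import Level
open import Relation.Binary.PropositionalEquality as ≡ using (_≡_)
import Relation.Binary.Reasoning.Setoid as SetoidReasoning
open import Relation.Nullary using (does; yes; no)
open import Relation.Nullary.Decidable using (does-⇔)

-- In the induction for the spanning the total degree need not drop: h^{(p)}_n contains J_{n+p},
-- which restores the p lost by the minor that omits column p. What drops is the degree of the
-- second factor alone, so the induction allows a first factor J_a with a arbitrary. Degrees are
-- only bounded above, because the entry J_{a+r} + J_{a-r} is not homogeneous. The number of factors
-- is recorded exactly, with J_0 = 1 counted as a factor and trailing zero parts kept in partitions:
-- the second factor can then be rewritten in characters with a known number of parts, which is an
-- outer induction on that number. In the annihilation formula, the range of rows t that can
-- contribute to the sum with J_{λ_t-t+2+k} grows with k. The sums over rows and over exponents of u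
-- can be exchanged because J(u)⁻¹ has no negative powers, which bounds k from above and so gives
-- one range for all exponents.

-- Finitely supported sums over ℕ and ℤ

module FiniteSumProperties {a ℓ} (M : CommutativeMonoid a ℓ) where
  open CommutativeMonoid M
  open MonoidSum M
  open FiniteSum M
  open SetoidReasoning setoid

  ∑-zero : ∀ n {f : Fin n → Carrier} → (∀ i → f i ≈ ε) → sum f ≈ ε
  ∑-zero n f≈ε = trans (sum-cong-≋ f≈ε) (sum-replicate-zero n)

  ∑-extend : ∀ {m n} (f : ℕ → Carrier) → m ℕ.≤ n → (∀ t → m ℕ.≤ t → f t ≈ ε) →
             (∑[ t < m ] f (toℕ t)) ≈ (∑[ t < n ] f (toℕ t))
  ∑-extend {n = n} f z≤n       f≈ε = sym (∑-zero n λ t → f≈ε (toℕ t) z≤n)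
  ∑-extend         f (s≤s m≤n) f≈ε = ∙-congˡ (∑-extend (f ∘ suc) m≤n λ t m≤t → f≈ε (suc t) (s≤s m≤t))

  -- Both partial sums agree with the one up to the larger bound. This frees the value from the
  -- bound stored in the witness, so that one bound can serve a whole family of sums.
  HasSumℕ-value : ∀ {f x} → HasSumℕ f x → ∀ N → (∀ t → N ℕ.≤ t → f t ≈ ε) →
                  (∑[ t < N ] f (toℕ t)) ≈ x
  HasSumℕ-value {f} (N₀ , f≈ε , sum≈x) N f≈ε′ =
    trans (∑-extend f (ℕ.m≤m⊔n N N₀) f≈ε′)
      (trans (sym (∑-extend f (ℕ.m≤n⊔m N N₀) f≈ε)) sum≈x)

  HasSumℕ-unique : ∀ {f x y} → HasSumℕ f x → HasSumℕ f y → x ≈ y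
  HasSumℕ-unique p (N , f≈ε , sum≈y) = trans (sym (HasSumℕ-value p N f≈ε)) sum≈y

  HasSumℕ-cong : ∀ {f g x y} → (∀ t → f t ≈ g t) → x ≈ y → HasSumℕ f x → HasSumℕ g y
  HasSumℕ-cong f≈g x≈y (N , f≈ε , sum≈x) =
    N , (λ t N≤t → trans (sym (f≈g t)) (f≈ε t N≤t))
      , trans (sum-cong-≋ {N} (λ t → sym (f≈g (toℕ t)))) (trans sum≈x x≈y)

  HasSumℕ-∙ : ∀ {f g x y} → HasSumℕ f x → HasSumℕ g y → HasSumℕ (λ t → f t ∙ g t) (x ∙ y)
  HasSumℕ-∙ {f} {g} p@(N₁ , f≈ε , _) q@(N₂ , g≈ε , _) =
    N₁ ⊔ N₂ , (λ t le → trans (∙-cong (f≈ε′ t le) (g≈ε′ t le)) (identityˡ ε)) ,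
    trans (∑-distrib-+ {N₁ ⊔ N₂} (f ∘ toℕ) (g ∘ toℕ))
      (∙-cong (HasSumℕ-value p _ f≈ε′) (HasSumℕ-value q _ g≈ε′))
    where
    f≈ε′ : ∀ t → N₁ ⊔ N₂ ℕ.≤ t → f t ≈ ε
    f≈ε′ t le = f≈ε t (ℕ.≤-trans (ℕ.m≤m⊔n N₁ N₂) le)
    g≈ε′ : ∀ t → N₁ ⊔ N₂ ℕ.≤ t → g t ≈ ε
    g≈ε′ t le = g≈ε t (ℕ.≤-trans (ℕ.m≤n⊔m N₁ N₂) le)

  ∑± : ℕ → (ℤ → Carrier) → Carrier
  ∑± N f = (∑[ t < N ] f (+ toℕ t)) ∙ (∑[ t < N ] f -[1+ toℕ t ])

  ∑±-extend : ∀ {m n} (f : ℤ → Carrier) → m ℕ.≤ n → (∀ s → m ℕ.≤ ∣ s ∣ → f s ≈ ε) → ∑± m f ≈ ∑± n f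
  ∑±-extend f m≤n f≈ε = ∙-cong (∑-extend (f ∘ +_) m≤n λ t → f≈ε (+ t))
    (∑-extend (f ∘ -[1+_]) m≤n λ t m≤t → f≈ε -[1+ t ] (ℕ.m≤n⇒m≤1+n m≤t))

  HasSumℤ-cong : ∀ {f g x y} → (∀ t → f t ≈ g t) → x ≈ y → HasSumℤ f x → HasSumℤ g y
  HasSumℤ-cong f≈g x≈y (N , f≈ε , sum≈x) =
    N , (λ t N≤t → trans (sym (f≈g t)) (f≈ε t N≤t))
      , trans (∙-cong (sum-cong-≋ {N} (λ t → sym (f≈g (+ toℕ t))))
                      (sum-cong-≋ {N} (λ t → sym (f≈g -[1+ toℕ t ])))) (trans sum≈x x≈y)

  HasSumℤ-ε : HasSumℤ (λ _ → ε) ε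
  HasSumℤ-ε = 0 , (λ _ _ → refl) , identityˡ ε

  HasSumℤ-∙ : ∀ {f g x y} → HasSumℤ f x → HasSumℤ g y → HasSumℤ (λ t → f t ∙ g t) (x ∙ y)
  HasSumℤ-∙ {f} {g} (N₁ , f≈ε , Σf) (N₂ , g≈ε , Σg) =
    N , (λ t le → trans (∙-cong (f≈ε′ t le) (g≈ε′ t le)) (identityˡ ε)) , (begin
      ∑± N (λ t → f t ∙ g t)
        ≈⟨ ∙-cong (∑-distrib-+ {N} (f ∘ +_ ∘ toℕ) (g ∘ +_ ∘ toℕ))
                  (∑-distrib-+ {N} (f ∘ -[1+_] ∘ toℕ) (g ∘ -[1+_] ∘ toℕ)) ⟩
      _ ≈⟨ solve 4 (λ a b c d → (a ⊕ b) ⊕ (c ⊕ d) ⊜ (a ⊕ c) ⊕ (b ⊕ d)) refl _ _ _ _ ⟩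
      ∑± N f ∙ ∑± N g
        ≈⟨ ∙-cong (trans (sym (∑±-extend f (ℕ.m≤m⊔n N₁ N₂) f≈ε)) Σf)
                  (trans (sym (∑±-extend g (ℕ.m≤n⊔m N₁ N₂) g≈ε)) Σg) ⟩
      _ ∎)
    where
    open MonoidSolver M
    N = N₁ ⊔ N₂
    f≈ε′ : ∀ t → N ℕ.≤ ∣ t ∣ → f t ≈ ε
    f≈ε′ t le = f≈ε t (ℕ.≤-trans (ℕ.m≤m⊔n N₁ N₂) le)
    g≈ε′ : ∀ t → N ℕ.≤ ∣ t ∣ → g t ≈ ε
    g≈ε′ t le = g≈ε t (ℕ.≤-trans (ℕ.m≤n⊔m N₁ N₂) le)

  HasSumℤ-∑ : ∀ n {f : Fin n → ℤ → Carrier} {x : Fin n → Carrier} →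
              (∀ i → HasSumℤ (f i) (x i)) → HasSumℤ (λ t → ∑[ i < n ] f i t) (sum x)
  HasSumℤ-∑ zero    p = HasSumℤ-ε
  HasSumℤ-∑ (suc n) p = HasSumℤ-∙ (p zero) (HasSumℤ-∑ n (p ∘ suc))

  private
    ∣i∣≤∣i+j∣+∣j∣ : ∀ i j → ∣ i ∣ ℕ.≤ ∣ i ℤ.+ j ∣ ℕ.+ ∣ j ∣
    ∣i∣≤∣i+j∣+∣j∣ i j = ≡.subst (λ k → ∣ k ∣ ℕ.≤ ∣ i ℤ.+ j ∣ ℕ.+ ∣ j ∣)
      (≡.trans (ℤ.+-assoc i j (ℤ.- j)) (≡.trans (≡.cong (λ k → i ℤ.+ k) (ℤ.+-inverseʳ j)) (ℤ.+-identityʳ i)))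
      (ℕ.≤-trans (ℤ.∣i+j∣≤∣i∣+∣j∣ (i ℤ.+ j) (ℤ.- j))
        (ℕ.≤-reflexive (≡.cong (∣ i ℤ.+ j ∣ ℕ.+_) (ℤ.∣-i∣≡∣i∣ j))))

  -- The negative half of the shifted sum begins with `f 0ℤ`, which moves to the nonnegative half;
  -- the window `suc N` is wide enough at both ends.
  HasSumℤ-suc : ∀ {f x} → HasSumℤ f x → HasSumℤ (λ s → f (s ℤ.+ 1ℤ)) x
  HasSumℤ-suc {f} {x} (N , f≈ε , sum≈x) = suc N , vanish , (begin
    (∑[ t < suc N ] f (+ toℕ t ℤ.+ 1ℤ)) ∙ (f 0ℤ ∙ ∑[ t < N ] f -[1+ toℕ t ])
      ≈⟨ ∙-congʳ (sum-cong-≋ {suc N} λ t → reflexive (≡.cong f (ℤ.+-comm (+ toℕ t) 1ℤ))) ⟩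
    (∑[ t < suc N ] f (+ suc (toℕ t))) ∙ (f 0ℤ ∙ ∑[ t < N ] f -[1+ toℕ t ])
      ≈⟨ solve 3 (λ a b c → a ⊕ (b ⊕ c) ⊜ (b ⊕ a) ⊕ c) refl _ _ _ ⟩
    (∑[ t < suc (suc N) ] f (+ toℕ t)) ∙ (∑[ t < N ] f -[1+ toℕ t ])
      ≈⟨ ∙-congʳ (∑-extend (f ∘ +_) (ℕ.m≤n+m N 2) (λ t → f≈ε (+ t))) ⟨
    ∑± N f
      ≈⟨ sum≈x ⟩
    x ∎)
    where
    open MonoidSolver M
    vanish : ∀ s → suc N ℕ.≤ ∣ s ∣ → f (s ℤ.+ 1ℤ) ≈ ε
    vanish s N<s = f≈ε _ (ℕ.≤-pred (ℕ.≤-trans N<s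
      (ℕ.≤-trans (∣i∣≤∣i+j∣+∣j∣ s 1ℤ) (ℕ.≤-reflexive (ℕ.+-comm _ 1)))))

  -- s ↦ -1 - s exchanges the two halves of the range -N, …, N - 1.
  HasSumℤ-reflect : ∀ {f x} → HasSumℤ f x → HasSumℤ (λ s → f (-1ℤ ℤ.- s)) x
  HasSumℤ-reflect {f} (N , f≈ε , sum≈x) = suc N , vanish ,
    trans (∙-cong (sum-cong-≋ {suc N} λ t → reflexive (≡.cong f (lemma⁺ (toℕ t))))
                  (sum-cong-≋ {suc N} λ t → reflexive (≡.cong f (lemma⁻ (toℕ t)))))
      (trans (comm _ _) (trans (sym (∑±-extend f (ℕ.n≤1+n N) f≈ε)) sum≈x))
    where
    lemma⁺ : ∀ t → -1ℤ ℤ.- + t ≡ -[1+ t ]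
    lemma⁺ zero    = ≡.refl
    lemma⁺ (suc t) = ≡.refl
    lemma⁻ : ∀ t → -1ℤ ℤ.- -[1+ t ] ≡ + t
    lemma⁻ t = ≡.refl
    vanish : ∀ s → suc N ℕ.≤ ∣ s ∣ → f (-1ℤ ℤ.- s) ≈ ε
    vanish s N<s = f≈ε _ (ℕ.≤-pred (ℕ.≤-trans (≡.subst (suc N ℕ.≤_) (≡.sym (ℤ.∣-i∣≡∣i∣ s)) N<s)
      (ℕ.≤-trans (∣i∣≤∣i+j∣+∣j∣ (ℤ.- s) -1ℤ)
        (ℕ.≤-reflexive (≡.trans (ℕ.+-comm _ 1) (≡.cong (suc ∘ ∣_∣) (ℤ.+-comm (ℤ.- s) -1ℤ)))))))

  -- Conjugating the shift by 1 with the reflection gives the shift by -1, since -1 - ((-1 - s) + 1)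
  -- = s - 1.
  HasSumℤ-pred : ∀ {f x} → HasSumℤ f x → HasSumℤ (λ s → f (s ℤ.+ -1ℤ)) x
  HasSumℤ-pred {f} p = HasSumℤ-cong (λ s → reflexive (≡.cong f (lemma s))) refl
    (HasSumℤ-reflect (HasSumℤ-suc (HasSumℤ-reflect p)))
    where
    lemma : ∀ s → -1ℤ ℤ.- (-1ℤ ℤ.- s ℤ.+ 1ℤ) ≡ s ℤ.+ -1ℤ
    lemma = solve-∀

  HasSumℤ-shift : ∀ c {f x} → HasSumℤ f x → HasSumℤ (λ s → f (s ℤ.+ c)) x
  HasSumℤ-shift (+ zero)      {f} p = HasSumℤ-cong (λ s → reflexive (≡.cong f (≡.sym (ℤ.+-identityʳ s)))) refl p
  HasSumℤ-shift (+ suc n)     {f} p = HasSumℤ-cong (λ s → reflexive (≡.cong f (ℤ.+-assoc s 1ℤ (+ n)))) refl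
                                      (HasSumℤ-suc (HasSumℤ-shift (+ n) p))
  HasSumℤ-shift -[1+ zero ]   {f} p = HasSumℤ-pred p
  HasSumℤ-shift -[1+ suc n ]  {f} p = HasSumℤ-cong (λ s → reflexive (≡.cong f (ℤ.+-assoc s -1ℤ -[1+ n ]))) refl
                                      (HasSumℤ-pred (HasSumℤ-shift -[1+ n ] p))

-- Images of sums under monoid homomorphisms

module SumHomomorphism {a ℓ b ℓ′} (M : CommutativeMonoid a ℓ) (N : CommutativeMonoid b ℓ′)
  (φ : CommutativeMonoid.Carrier M → CommutativeMonoid.Carrier N)
  (φ-cong : ∀ {x y} → CommutativeMonoid._≈_ M x y → CommutativeMonoid._≈_ N (φ x) (φ y))
  (φ-ε : CommutativeMonoid._≈_ N (φ (CommutativeMonoid.ε M)) (CommutativeMonoid.ε N))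
  (φ-∙ : ∀ x y → CommutativeMonoid._≈_ N (φ (CommutativeMonoid._∙_ M x y)) (CommutativeMonoid._∙_ N (φ x) (φ y))) where
  private
    module M = CommutativeMonoid M
    module N = CommutativeMonoid N
    module M∑ where
      open MonoidSum M public
      open FiniteSum M public
    module N∑ where
      open MonoidSum N public
      open FiniteSum N public

  ∑-map : ∀ {n} (f : Fin n → M.Carrier) → φ (M∑.sum f) N.≈ N∑.sum (φ ∘ f)
  ∑-map {zero}  f = φ-ε
  ∑-map {suc n} f = N.trans (φ-∙ _ _) (N.∙-congˡ (∑-map (f ∘ suc)))

  HasSumℕ-map : ∀ {f x} → M∑.HasSumℕ f x → N∑.HasSumℕ (φ ∘ f) (φ x)
  HasSumℕ-map {f} (N , f≈ε , sum≈x) = N , (λ t N≤t → N.trans (φ-cong (f≈ε t N≤t)) φ-ε) ,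
    N.trans (N.sym (∑-map {N} (f ∘ toℕ))) (φ-cong sum≈x)

  HasSumℤ-map : ∀ {f x} → M∑.HasSumℤ f x → N∑.HasSumℤ (φ ∘ f) (φ x)
  HasSumℤ-map {f} (N , f≈ε , sum≈x) = N , (λ t N≤t → N.trans (φ-cong (f≈ε t N≤t)) φ-ε) ,
    N.trans (N.sym (N.trans (φ-∙ _ _) (N.∙-cong (∑-map {N} (f ∘ +_ ∘ toℕ)) (∑-map {N} (f ∘ -[1+_] ∘ toℕ)))))
      (φ-cong sum≈x)

-- Determinants

punchIn-pinch : ∀ {n} (p : Fin (suc n)) (k : Fin n) → punchIn (punchIn p k) (pinch k p) ≡ p
punchIn-pinch {suc n} zero    k       = ≡.refl
punchIn-pinch {suc n} (suc p) zero    = ≡.refl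
punchIn-pinch {suc n} (suc p) (suc k) = ≡.cong suc (punchIn-pinch p k)

-- The same two indices can be deleted in either order: `p` and then `k`, or `punchIn p k` and then
-- `pinch k p`, the place of `p` among the indices that remain.
punchIn-comm : ∀ {n} (p : Fin (suc (suc n))) (k : Fin (suc n)) (j : Fin n) →
               punchIn p (punchIn k j) ≡ punchIn (punchIn p k) (punchIn (pinch k p) j)
punchIn-comm zero    k       j       = ≡.refl
punchIn-comm (suc p) zero    j       = ≡.refl
punchIn-comm (suc p) (suc k) zero    = ≡.refl
punchIn-comm (suc p) (suc k) (suc j) = ≡.cong suc (punchIn-comm p k j)

-- The two orders of deletion have opposite parity; this is the sign in the exchange of row and
-- column expansions.
toℕ-punchIn-pinch : ∀ {n} (p : Fin (suc n)) (k : Fin n) →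
                    toℕ p ℕ.+ toℕ (punchIn p k) ≡ suc (toℕ k ℕ.+ toℕ (pinch k p))
toℕ-punchIn-pinch {suc n} zero    k       = ≡.cong suc (≡.sym (ℕ.+-identityʳ _))
toℕ-punchIn-pinch {suc n} (suc p) zero    = ≡.cong suc (ℕ.+-identityʳ _)
toℕ-punchIn-pinch {suc n} (suc p) (suc k) = ≡.cong suc (≡.trans (ℕ.+-suc _ _)
  (≡.cong suc (≡.trans (toℕ-punchIn-pinch p k) (≡.sym (ℕ.+-suc _ _)))))

punchIn-inject₁ : ∀ {n} (k : Fin (suc n)) (j : Fin n) →
                  punchIn (inject₁ k) (inject₁ j) ≡ inject₁ (punchIn k j)
punchIn-inject₁ zero    j       = ≡.refl
punchIn-inject₁ (suc k) zero    = ≡.refl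
punchIn-inject₁ (suc k) (suc j) = ≡.cong suc (punchIn-inject₁ k j)

punchIn-inject₁-fromℕ : ∀ {n} (k : Fin (suc n)) → punchIn (inject₁ k) (fromℕ n) ≡ fromℕ (suc n)
punchIn-inject₁-fromℕ         zero    = ≡.refl
punchIn-inject₁-fromℕ {suc n} (suc k) = ≡.cong suc (punchIn-inject₁-fromℕ k)

punchIn-fromℕ : ∀ {n} (j : Fin n) → punchIn (fromℕ n) j ≡ inject₁ j
punchIn-fromℕ zero    = ≡.refl
punchIn-fromℕ (suc j) = ≡.cong suc (punchIn-fromℕ j)

module AlternatingProperties {a ℓ} (A : AbelianGroup a ℓ) where
  open AbelianGroup A
  open AbelianGroupProperties A
  open Alternating A

  sign-cong : ∀ n {x y} → x ≈ y → [-1]^ n · x ≈ [-1]^ n · y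
  sign-cong zero    x≈y = x≈y
  sign-cong (suc n) x≈y = ⁻¹-cong (sign-cong n x≈y)

  sign-congˡ : ∀ {m n x} → m ≡ n → [-1]^ m · x ≈ [-1]^ n · x
  sign-congˡ ≡.refl = refl

  sign-ε : ∀ n → [-1]^ n · ε ≈ ε
  sign-ε zero    = refl
  sign-ε (suc n) = trans (⁻¹-cong (sign-ε n)) ε⁻¹≈ε

  sign-∙ : ∀ n x y → [-1]^ n · (x ∙ y) ≈ ([-1]^ n · x) ∙ ([-1]^ n · y)
  sign-∙ zero    x y = refl
  sign-∙ (suc n) x y = trans (⁻¹-cong (sign-∙ n x y)) (sym (⁻¹-∙-comm _ _))

  sign-⁻¹ : ∀ n x → [-1]^ n · (x ⁻¹) ≈ ([-1]^ n · x) ⁻¹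
  sign-⁻¹ zero    x = refl
  sign-⁻¹ (suc n) x = ⁻¹-cong (sign-⁻¹ n x)

  sign-+ : ∀ m n x → [-1]^ m ℕ.+ n · x ≡ [-1]^ m · [-1]^ n · x
  sign-+ zero    n x = ≡.refl
  sign-+ (suc m) n x = ≡.cong _⁻¹ (sign-+ m n x)

  sign-comm : ∀ m n x → [-1]^ m · [-1]^ n · x ≈ [-1]^ n · [-1]^ m · x
  sign-comm m n x = trans (reflexive (≡.sym (sign-+ m n x)))
    (trans (sign-congˡ (ℕ.+-comm m n)) (reflexive (sign-+ n m x)))

  sign-involutive : ∀ n x → [-1]^ n · [-1]^ n · x ≈ x
  sign-involutive zero    x = refl
  sign-involutive (suc n) x = trans (⁻¹-cong (sign-⁻¹ n _))
    (trans (⁻¹-involutive _) (sign-involutive n x))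

module DeterminantProperties {r ℓ} (R : CommutativeRing r ℓ) where
  open CommutativeRing R hiding (zero)
  open Determinant R
  open Alternating +-abelianGroup
  open AlternatingProperties +-abelianGroup public
  open RingProperties ring
  open SemiringSum semiring
  open FiniteSumProperties +-commutativeMonoid
  open SetoidReasoning setoid

  sign-*ˡ : ∀ n x y → ([-1]^ n · x) * y ≈ [-1]^ n · (x * y)
  sign-*ˡ zero    x y = refl
  sign-*ˡ (suc n) x y = trans (sym (-‿distribˡ-* _ y)) (-‿cong (sign-*ˡ n x y))

  sign-*ʳ : ∀ n x y → x * ([-1]^ n · y) ≈ [-1]^ n · (x * y)
  sign-*ʳ zero    x y = refl
  sign-*ʳ (suc n) x y = trans (sym (-‿distribʳ-* x _)) (-‿cong (sign-*ʳ n x y))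

  sign-∑ : ∀ n {m} (f : Fin m → Carrier) → [-1]^ n · sum f ≈ ∑[ i < m ] ([-1]^ n · f i)
  sign-∑ n {zero}  f = sign-ε n
  sign-∑ n {suc m} f = trans (sign-∙ n _ _) (+-congˡ (sign-∑ n (f ∘ suc)))

  sign-*-∑ : ∀ n x {m} (f : Fin m → Carrier) → [-1]^ n · (x * sum f) ≈ ∑[ i < m ] ([-1]^ n · (x * f i))
  sign-*-∑ n x f = trans (sign-cong n (*-distribˡ-sum x f)) (sign-∑ n (λ i → x * f i))

  det-cong : ∀ {n} {M M′ : Fin n → Fin n → Carrier} → (∀ i j → M i j ≈ M′ i j) → det M ≈ det M′
  det-cong {zero}  M≈M′ = refl
  det-cong {suc n} M≈M′ = sum-cong-≋ λ k → sign-cong (toℕ k)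
    (*-cong (M≈M′ zero k) (det-cong λ i j → M≈M′ (suc i) (punchIn k j)))

  -- The expansion along its first column of the square matrix [ c | N ].
  laplace : ∀ {n} → (Fin (suc n) → Carrier) → (Fin (suc n) → Fin n → Carrier) → Carrier
  laplace {n} c N = ∑[ t < suc n ] ([-1]^ toℕ t · (c t * det (λ i → N (punchIn t i))))

  laplace-cong : ∀ {n} {c c′ : Fin (suc n) → Carrier} {N N′ : Fin (suc n) → Fin n → Carrier} →
                 (∀ i → c i ≈ c′ i) → (∀ i j → N i j ≈ N′ i j) → laplace c N ≈ laplace c′ N′
  laplace-cong {n} c≈c′ N≈N′ = sum-cong-≋ {suc n} λ t →
    sign-cong (toℕ t) (*-cong (c≈c′ t) (det-cong λ i → N≈N′ (punchIn t i)))

  -- Every minor with t > 0 still has row zero of `N` on top and is expanded along it; exchanging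
  -- the two sums leaves smaller column expansions. The minus sign is the parity of `suc t` against
  -- `t`.
  laplace-rec : ∀ {n} (c : Fin (suc (suc n)) → Carrier) (N : Fin (suc (suc n)) → Fin (suc n) → Carrier) →
    laplace c N ≈ c zero * det (N ∘ suc)
      - (∑[ k < suc n ] ([-1]^ toℕ k · (N zero k * laplace (c ∘ suc) (λ i j → N (suc i) (punchIn k j)))))
  laplace-rec {n} c N = +-congˡ (begin
    ∑[ t < suc n ] ([-1]^ suc (toℕ t) · (c (suc t) * ∑[ k < suc n ] ([-1]^ toℕ k · (N zero k * m t k))))
      ≈⟨ sign-∑ 1 (λ t → [-1]^ toℕ t · (c (suc t) * ∑[ k < suc n ] ([-1]^ toℕ k · (N zero k * m t k)))) ⟨
    - (∑[ t < suc n ] ([-1]^ toℕ t · (c (suc t) * ∑[ k < suc n ] ([-1]^ toℕ k · (N zero k * m t k)))))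
      ≈⟨ -‿cong (sum-cong-≋ λ t → sign-*-∑ (toℕ t) (c (suc t)) (λ k → [-1]^ toℕ k · (N zero k * m t k))) ⟩
    - (∑[ t < suc n ] ∑[ k < suc n ] ([-1]^ toℕ t · (c (suc t) * ([-1]^ toℕ k · (N zero k * m t k)))))
      ≈⟨ -‿cong (∑-comm λ t k → [-1]^ toℕ t · (c (suc t) * ([-1]^ toℕ k · (N zero k * m t k)))) ⟩
    - (∑[ k < suc n ] ∑[ t < suc n ] ([-1]^ toℕ t · (c (suc t) * ([-1]^ toℕ k · (N zero k * m t k)))))
      ≈⟨ -‿cong (sum-cong-≋ λ k → sum-cong-≋ λ t → rearrange t k) ⟩
    - (∑[ k < suc n ] ∑[ t < suc n ] ([-1]^ toℕ k · (N zero k * ([-1]^ toℕ t · (c (suc t) * m t k)))))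
      ≈⟨ -‿cong (sum-cong-≋ λ k → sign-*-∑ (toℕ k) (N zero k) (λ t → [-1]^ toℕ t · (c (suc t) * m t k))) ⟨
    _ ∎)
    where
    m : Fin (suc n) → Fin (suc n) → Carrier
    m t k = det (λ i j → N (suc (punchIn t i)) (punchIn k j))
    rearrange : ∀ t k → [-1]^ toℕ t · (c (suc t) * ([-1]^ toℕ k · (N zero k * m t k)))
                ≈ [-1]^ toℕ k · (N zero k * ([-1]^ toℕ t · (c (suc t) * m t k)))
    rearrange t k = begin
      [-1]^ toℕ t · (c (suc t) * ([-1]^ toℕ k · (N zero k * m t k)))
        ≈⟨ sign-cong (toℕ t) (sign-*ʳ (toℕ k) _ _) ⟩
      [-1]^ toℕ t · [-1]^ toℕ k · (c (suc t) * (N zero k * m t k))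
        ≈⟨ sign-comm (toℕ t) (toℕ k) _ ⟩
      [-1]^ toℕ k · [-1]^ toℕ t · (c (suc t) * (N zero k * m t k))
        ≈⟨ sign-cong (toℕ k) (sign-cong (toℕ t) (trans (sym (*-assoc _ _ _))
             (trans (*-congʳ (*-comm _ _)) (*-assoc _ _ _)))) ⟩
      [-1]^ toℕ k · [-1]^ toℕ t · (N zero k * (c (suc t) * m t k))
        ≈⟨ sign-cong (toℕ k) (sign-*ʳ (toℕ t) _ _) ⟨
      _ ∎

  -- Induction on the size, with both sides expanded along row zero. The entry in column `p` gives
  -- its own term of `det M`; in every other minor column `p` sits at position `pinch k p`, and the
  -- induction hypothesis supplies its expansion.
  laplace-column : ∀ {n} (M : Fin (suc n) → Fin (suc n) → Carrier) p →
    laplace (λ i → M i p) (λ i j → M i (punchIn p j)) ≈ [-1]^ toℕ p · det M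
  laplace-column {zero}  M zero = refl
  laplace-column {suc n} M p    = begin
    laplace (λ i → M i p) (λ i j → M i (punchIn p j))
      ≈⟨ laplace-rec (λ i → M i p) (λ i j → M i (punchIn p j)) ⟩
    M zero p * det (m p)
      - (∑[ k < suc n ] ([-1]^ toℕ k · (M zero (punchIn p k) * laplace (λ i → M (suc i) p)
          (λ i j → M (suc i) (punchIn p (punchIn k j))))))
      ≈⟨ +-cong (sym (sign-involutive (toℕ p) _)) (sign-∑ 1 λ k → [-1]^ toℕ k · (M zero (punchIn p k) * laplace (λ i → M (suc i) p)
          (λ i j → M (suc i) (punchIn p (punchIn k j))))) ⟩
    [-1]^ toℕ p · term p
      + (∑[ k < suc n ] ([-1]^ suc (toℕ k) · (M zero (punchIn p k) * laplace (λ i → M (suc i) p)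
          (λ i j → M (suc i) (punchIn p (punchIn k j))))))
      ≈⟨ +-congˡ (sum-cong-≋ other) ⟩
    [-1]^ toℕ p · term p + (∑[ k < suc n ] ([-1]^ toℕ p · term (punchIn p k)))
      ≈⟨ +-congˡ (sign-∑ (toℕ p) λ k → term (punchIn p k)) ⟨
    [-1]^ toℕ p · term p + [-1]^ toℕ p · (∑[ k < suc n ] term (punchIn p k))
      ≈⟨ sign-∙ (toℕ p) _ _ ⟨
    [-1]^ toℕ p · (term p + (∑[ k < suc n ] term (punchIn p k)))
      ≈⟨ sign-cong (toℕ p) (sum-remove {suc n} {p} term) ⟨
    [-1]^ toℕ p · det M ∎
    where
    m : Fin (suc (suc n)) → Fin (suc n) → Fin (suc n) → Carrier
    m k i j = M (suc i) (punchIn k j)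
    term : Fin (suc (suc n)) → Carrier
    term k = [-1]^ toℕ k · (M zero k * det (m k))
    other : ∀ k → [-1]^ suc (toℕ k) · (M zero (punchIn p k) * laplace (λ i → M (suc i) p)
                    (λ i j → M (suc i) (punchIn p (punchIn k j))))
                  ≈ [-1]^ toℕ p · term (punchIn p k)
    other k = begin
      [-1]^ suc (toℕ k) · (M zero k′ * laplace (λ i → M (suc i) p) (λ i j → M (suc i) (punchIn p (punchIn k j))))
        ≈⟨ sign-cong (suc (toℕ k)) (*-congˡ (trans
             (laplace-cong (λ i → reflexive (≡.cong (M (suc i)) (≡.sym (punchIn-pinch p k))))
                           (λ i j → reflexive (≡.cong (M (suc i)) (punchIn-comm p k j))))
             (laplace-column (m k′) p′))) ⟩
      [-1]^ suc (toℕ k) · (M zero k′ * ([-1]^ toℕ p′ · det (m k′)))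
        ≈⟨ sign-cong (suc (toℕ k)) (sign-*ʳ (toℕ p′) _ _) ⟩
      [-1]^ suc (toℕ k) · [-1]^ toℕ p′ · (M zero k′ * det (m k′))
        ≡⟨ sign-+ (suc (toℕ k)) (toℕ p′) _ ⟨
      [-1]^ suc (toℕ k ℕ.+ toℕ p′) · (M zero k′ * det (m k′))
        ≈⟨ sign-congˡ (toℕ-punchIn-pinch p k) ⟨
      [-1]^ toℕ p ℕ.+ toℕ k′ · (M zero k′ * det (m k′))
        ≡⟨ sign-+ (toℕ p) (toℕ k′) _ ⟩
      [-1]^ toℕ p · term k′ ∎
      where
      k′ = punchIn p k
      p′ = pinch k p

  -- The matrix [ column q of N | N ] has two equal columns.
  laplace-repeated : ∀ {n} (N : Fin (suc n) → Fin n → Carrier) q → laplace (λ i → N i q) N ≈ 0#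
  laplace-repeated {suc n} N q = begin
    laplace (λ i → N i q) N
      ≈⟨ laplace-rec (λ i → N i q) N ⟩
    N zero q * det (N ∘ suc) - (∑[ k < suc n ] term k)
      ≈⟨ +-congˡ (-‿cong (sum-remove {n} {q} term)) ⟩
    N zero q * det (N ∘ suc) - (term q + (∑[ k < n ] term (punchIn q k)))
      ≈⟨ +-congˡ (-‿cong (trans (+-cong same (∑-zero n other)) (+-identityʳ _))) ⟩
    N zero q * det (N ∘ suc) - N zero q * det (N ∘ suc)
      ≈⟨ -‿inverseʳ _ ⟩
    0# ∎
    where
    term : Fin (suc n) → Carrier
    term k = [-1]^ toℕ k · (N zero k * laplace (λ i → N (suc i) q) (λ i j → N (suc i) (punchIn k j)))
    -- For k = q the repeated column is the deleted one: `laplace-column` puts it back in place, and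
    -- the term cancels the first one. Any other k leaves a smaller matrix that still has a repeated
    -- column.
    same : term q ≈ N zero q * det (N ∘ suc)
    same = trans (sign-cong (toℕ q) (trans (*-congˡ (laplace-column (N ∘ suc) q)) (sign-*ʳ (toℕ q) _ _)))
                 (sign-involutive (toℕ q) _)
    other : ∀ k → term (punchIn q k) ≈ 0#
    other k = trans (sign-cong (toℕ (punchIn q k)) (trans (*-congˡ (trans
        (laplace-cong {c = λ i → N (suc i) q} {N = λ i j → N (suc i) (punchIn (punchIn q k) j)}
          (λ i → reflexive (≡.cong (N (suc i)) (≡.sym (punchIn-pinch q k)))) (λ _ _ → refl))
        (laplace-repeated (λ i j → N (suc i) (punchIn (punchIn q k) j)) (pinch k q)))) (zeroʳ _)))
      (sign-ε (toℕ (punchIn q k)))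

  det-zeroRow : ∀ {n} (M : Fin (suc n) → Fin (suc n) → Carrier) →
                (∀ j → M (fromℕ n) j ≈ 0#) → det M ≈ 0#
  det-zeroRow {zero}  M M≈0 = trans (+-identityʳ _) (trans (*-congʳ (M≈0 zero)) (zeroˡ _))
  det-zeroRow {suc n} M M≈0 = ∑-zero (suc (suc n)) λ k →
    trans (sign-cong (toℕ k) (trans (*-congˡ (det-zeroRow (λ i j → M (suc i) (punchIn k j)) (λ j → M≈0 (punchIn k j)))) (zeroʳ (M zero k))))
          (sign-ε (toℕ k))

  -- In the expansion along row zero, the minors that keep the last column have a last row of the
  -- same shape; the one that omits it has a zero last row.
  det-unitRow : ∀ {n} (M : Fin (suc n) → Fin (suc n) → Carrier) →
    (∀ j → M (fromℕ n) (inject₁ j) ≈ 0#) → M (fromℕ n) (fromℕ n) ≈ 1# →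
    det M ≈ det (λ i j → M (inject₁ i) (inject₁ j))
  det-unitRow {zero}  M M≈0 M≈1 = trans (+-identityʳ _) (trans (*-identityʳ _) M≈1)
  det-unitRow {suc n} M M≈0 M≈1 = begin
    det M
      ≈⟨ sum-init-last term ⟩
    (∑[ k < suc n ] term (inject₁ k)) + term (fromℕ (suc n))
      ≈⟨ +-cong (sum-cong-≋ first) final ⟩
    det (λ i j → M (inject₁ i) (inject₁ j)) + 0#
      ≈⟨ +-identityʳ _ ⟩
    det (λ i j → M (inject₁ i) (inject₁ j)) ∎
    where
    term : Fin (suc (suc n)) → Carrier
    term k = [-1]^ toℕ k · (M zero k * det (λ i j → M (suc i) (punchIn k j)))
    first : ∀ k → term (inject₁ k) ≈ [-1]^ toℕ k · (M zero (inject₁ k) *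
              det (λ i j → M (suc (inject₁ i)) (inject₁ (punchIn k j))))
    first k = trans (sign-congˡ (toℕ-inject₁ k)) (sign-cong (toℕ k) (*-congˡ (trans
      (det-unitRow (λ i j → M (suc i) (punchIn (inject₁ k) j))
        (λ j → trans (reflexive (≡.cong (M _) (punchIn-inject₁ k j))) (M≈0 (punchIn k j)))
        (trans (reflexive (≡.cong (M _) (punchIn-inject₁-fromℕ k))) M≈1))
      (det-cong λ i j → reflexive (≡.cong (M _) (punchIn-inject₁ k j))))))
    final : term (fromℕ (suc n)) ≈ 0#
    final = trans (sign-cong (toℕ (fromℕ (suc n))) (trans (*-congˡ (det-zeroRow (λ i j → M (suc i) (punchIn (fromℕ (suc n)) j))
        (λ j → trans (reflexive (≡.cong (M _) (punchIn-fromℕ j))) (M≈0 j)))) (zeroʳ _)))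
      (sign-ε (toℕ (fromℕ (suc n))))

-- Row indices of integer vectors

i≤j-from-difference : ∀ {i j} d → j ≡ i ℤ.+ + d → i ℤ.≤ j
i≤j-from-difference {i} d ≡.refl = ℤ.i≤i+j i (+ d)

part-beyond : ∀ α {i} → length α ℕ.≤ i → part α i ≡ 0ℤ
part-beyond []      le          = ≡.refl
part-beyond (a ∷ α) (ℕ.s≤s le) = part-beyond α le

length-remove : ∀ α {i M} → i ℕ.≤ M → length α ℕ.≤ M → length (remove i α) ℕ.≤ M
length-remove α {i} {M} i≤M l≤M = begin
  length (remove i α)
    ≡⟨ length-++ (applyUpTo (λ j → part α j ℤ.+ 1ℤ) i) ⟩
  length (applyUpTo (λ j → part α j ℤ.+ 1ℤ) i) ℕ.+ length (drop (suc i) α)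
    ≡⟨ ≡.cong₂ ℕ._+_ (length-applyUpTo _ i) (length-drop (suc i) α) ⟩
  i ℕ.+ (length α ℕ.∸ suc i)
    ≤⟨ ℕ.+-monoʳ-≤ i (ℕ.∸-mono l≤M (ℕ.n≤1+n i)) ⟩
  i ℕ.+ (M ℕ.∸ i)
    ≡⟨ ℕ.m+[n∸m]≡n i≤M ⟩
  M ∎
  where open ℕ.≤-Reasoning

shiftedPart : List ℤ → ℕ → ℤ
shiftedPart α i = part α i ℤ.- + i ℤ.+ 1ℤ

-- Rows before t gain 1 from the added 1, rows after t from moving up one place. So the determinants
-- s_(remove t α) are the maximal minors of one matrix with M + 1 rows and M columns, whose row
-- indices are the shifted parts.
part-remove : ∀ α {M} (t : Fin (suc M)) (i : Fin M) →
              part (remove (toℕ t) α) (toℕ i) ℤ.- + toℕ i ≡ shiftedPart α (toℕ (punchIn t i))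
part-remove α zero i = ≡.trans (≡.cong (ℤ._- + toℕ i) (part-drop α)) (lemma (part α (suc (toℕ i))) (+ toℕ i))
  where
  part-drop : ∀ α → part (drop 1 α) (toℕ i) ≡ part α (suc (toℕ i))
  part-drop []      = ≡.refl
  part-drop (_ ∷ _) = ≡.refl
  lemma : ∀ x i → x ℤ.- i ≡ x ℤ.- (1ℤ ℤ.+ i) ℤ.+ 1ℤ
  lemma = solve-∀
part-remove α (suc t) zero = lemma (part α 0)
  where
  lemma : ∀ x → x ℤ.+ 1ℤ ℤ.- 0ℤ ≡ x ℤ.- 0ℤ ℤ.+ 1ℤ
  lemma = solve-∀
part-remove α (suc t) (suc i) = ≡.trans (next (part (remove (toℕ t) (drop 1 α)) (toℕ i)) (+ toℕ i) (remove-drop α))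
  (≡.trans (≡.cong (ℤ._- 1ℤ) (part-remove (drop 1 α) t i)) (last′ (toℕ (punchIn t i))))
  where
  remove-drop : ∀ α → part (remove (suc (toℕ t)) α) (suc (toℕ i)) ≡ part (remove (toℕ t) (drop 1 α)) (toℕ i)
  remove-drop []      = ≡.refl
  remove-drop (_ ∷ _) = ≡.refl
  part-drop : ∀ α j → part (drop 1 α) j ≡ part α (suc j)
  part-drop []      j = ≡.refl
  part-drop (_ ∷ _) j = ≡.refl
  lemma : ∀ x i → x ℤ.- (1ℤ ℤ.+ i) ≡ x ℤ.- i ℤ.- 1ℤ
  lemma = solve-∀
  next : ∀ x i {y} → y ≡ x → y ℤ.- (1ℤ ℤ.+ i) ≡ x ℤ.- i ℤ.- 1ℤ
  next x i ≡.refl = lemma x i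
  lemma′ : ∀ x i → x ℤ.- i ℤ.+ 1ℤ ℤ.- 1ℤ ≡ x ℤ.- (1ℤ ℤ.+ i) ℤ.+ 1ℤ
  lemma′ = solve-∀
  last′ : ∀ j → shiftedPart (drop 1 α) j ℤ.- 1ℤ ≡ shiftedPart α (suc j)
  last′ j = ≡.trans (≡.cong (λ x → x ℤ.- + j ℤ.+ 1ℤ ℤ.- 1ℤ) (part-drop α j)) (lemma′ (part α (suc j)) (+ j))

-- Stability of the Jacobi-Trudi determinants

module FockSpaceProperties {c ℓ} (K : CommutativeRing c ℓ) (𝔤 : LieType) where
  open FockSpace K 𝔤
  open Determinant B-ring
  open Alternating +-abelianGroup
  open CommutativeRing B-ring
    using (setoid; ring; semiring; +-commutativeMonoid; reflexive; zeroˡ; zeroʳ; +-identityʳ;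
           distribˡ; *-identityʳ; -‿inverseʳ; +-congˡ; +-congʳ; *-congˡ; *-congʳ)
  open DeterminantProperties B-ring
  open RingProperties ring using (-1*x≈-x; -0#≈0#; -‿distribˡ-*; -‿distribʳ-*; -‿+-comm; -‿involutive)
  open SemiringSum semiring using (sum; sum-syntax; sum-cong-≋; ∑-distrib-+; *-distribˡ-sum; sum-init-last)
  open FiniteSum +-commutativeMonoid
  open FiniteSumProperties +-commutativeMonoid
  open SetoidReasoning setoid
  private
    module K = CommutativeRing K
    module ℤΣ = MonoidSum ℤ.+-0-commutativeMonoid
    module M where
      open LeftModule 𝓑-module public
      open FiniteSum +ᴹ-commutativeMonoid public
      open FiniteSumProperties +ᴹ-commutativeMonoid public
      open Alternating +ᴹ-abelianGroup public

  ∑ℤ : ∀ {n} → (Fin n → ℤ) → ℤ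
  ∑ℤ = ℤΣ.sum

  J-negative : ∀ {a} → a ℤ.< 0ℤ → J a ≈ 0#
  J-negative ℤ.-<+ = refl

  h-zero : ∀ a → h⟨ 0ℤ ⟩ a ≈ J a
  h-zero a = reflexive (≡.cong J (ℤ.+-identityʳ a))

  h-vanishes : ∀ r {a} → a ℤ.+ + r ℤ.< 0ℤ → h⟨ + r ⟩ a ≈ 0#
  h-vanishes zero    lt = J-negative lt
  h-vanishes (suc r) {a} lt = trans
    (+-cong (J-negative lt) (J-negative (ℤ.≤-<-trans (ℤ.+-monoʳ-≤ a ℤ.-≤+) lt))) (+-identityˡ 0#)

  jacobiTrudi-suc : ∀ {N} α → length α ℕ.≤ N → jacobiTrudi (suc N) α ≈ jacobiTrudi N α
  jacobiTrudi-suc {N} α le = trans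
    (det-unitRow (λ i j → h⟨ + toℕ j ⟩ (part α (toℕ i) ℤ.- + toℕ i))
      (λ j → trans (entry j) (below j)) (trans (entry′ _ (toℕ-fromℕ N)) (diagonal N)))
    (det-cong {N} λ i j → reflexive (≡.cong₂ (λ i j → h⟨ + j ⟩ (part α i ℤ.- + i)) (toℕ-inject₁ i) (toℕ-inject₁ j)))
    where
    entry′ : ∀ {i} j {k} → toℕ j ≡ k → h⟨ + toℕ {i} j ⟩ (part α (toℕ (fromℕ N)) ℤ.- + toℕ (fromℕ N))
               ≈ h⟨ + k ⟩ (ℤ.- + N)
    entry′ j ≡.refl = reflexive (≡.cong h⟨ + toℕ j ⟩ (≡.trans
      (≡.cong₂ (λ a i → a ℤ.- + i)
        (part-beyond α (≡.subst (length α ℕ.≤_) (≡.sym (toℕ-fromℕ N)) le)) (toℕ-fromℕ N))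
      (ℤ.+-identityˡ (ℤ.- + N))))
    entry : ∀ j → h⟨ + toℕ (inject₁ j) ⟩ (part α (toℕ (fromℕ N)) ℤ.- + toℕ (fromℕ N))
               ≈ h⟨ + toℕ j ⟩ (ℤ.- + N)
    entry j = entry′ (inject₁ j) (toℕ-inject₁ j)
    below : ∀ j → h⟨ + toℕ j ⟩ (ℤ.- + N) ≈ 0#
    below j = h-vanishes (toℕ j)
      (ℤ.<-≤-trans (ℤ.+-monoʳ-< (ℤ.- + N) (ℤ.+<+ (toℕ<n j))) (ℤ.≤-reflexive (ℤ.+-inverseˡ (+ N))))
    diagonal : ∀ N → h⟨ + N ⟩ (ℤ.- + N) ≈ 1#
    diagonal zero    = refl
    diagonal (suc N) = trans (+-cong (reflexive (≡.cong J (ℤ.+-inverseˡ (+ suc N)))) refl) (+-identityʳ 1#)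

  jacobiTrudi-stable : ∀ {N} α → length α ℕ.≤ N → jacobiTrudi N α ≈ s α
  jacobiTrudi-stable α le = go (ℕ.≤⇒≤′ le)
    where
    go : ∀ {N} → length α ℕ.≤′ N → jacobiTrudi N α ≈ s α
    go (ℕ.≤′-reflexive ≡.refl) = refl
    go (ℕ.≤′-step le)          = trans (jacobiTrudi-suc α (ℕ.≤′⇒≤ le)) (go le)

  s-partition : ∀ α → s ⌜ α ⌝ ≡ jacobiTrudi (length α) ⌜ α ⌝
  s-partition α = ≡.cong (λ N → jacobiTrudi N ⌜ α ⌝) (length-map +_ α)

  -- The value of D_p on s_α.
  omitColumn : ∀ α → Fin (suc (length α)) → B
  omitColumn α p = det {length α} (λ i j → h⟨ + toℕ (punchIn p j) ⟩ (part ⌜ α ⌝ (toℕ i) ℤ.- + suc (toℕ i)))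

  -- `det` is defined by this expansion; prepending n moves row i of α one place down, which turns
  -- its index into the one in D_p.
  s-∷ : ∀ n α → s (n ∷ ⌜ α ⌝) ≈ ∑[ p < suc (length α) ] ([-1]^ toℕ p · (h⟨ + toℕ p ⟩ n * omitColumn α p))
  s-∷ n α = trans (reflexive (≡.cong (λ N → jacobiTrudi (suc N) (n ∷ ⌜ α ⌝)) (length-map +_ α)))
    (sum-cong-≋ {suc (length α)} λ p → sign-cong (toℕ p) (*-congʳ {x = omitColumn α p} (reflexive (≡.cong h⟨ + toℕ p ⟩ (ℤ.+-identityʳ n)))))

  -- The irreducible characters span B

  -- Membership is a derivation, so linear statements follow by recursion on it; `resp` is needed
  -- because elements of `B` are terms modulo `_≈_`.
  data Span {p} (P : B → Set p) : B → Set (c Level.⊔ ℓ Level.⊔ p) where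
    generator : ∀ {x} → P x → Span P x
    zero      : Span P 0#
    add       : ∀ {x y} → Span P x → Span P y → Span P (x + y)
    scale     : ∀ a {x} → Span P x → Span P (con a * x)
    resp      : ∀ {x y} → x ≈ y → Span P x → Span P y

  con-neg : ∀ x → con (K.- K.1#) * x ≈ - x
  con-neg x = trans (*-congʳ (trans (sym (+-identityʳ _)) (trans (+-congˡ (sym (-‿inverseʳ 1#)))
    (trans (sym (+-assoc _ _ _)) (trans (+-congʳ (trans (sym (+-homo _ _)) (con-cong (K.-‿inverseˡ K.1#))))
    (+-identityˡ _)))))) (-1*x≈-x x)

  module _ {p} {P : B → Set p} where
    Span-neg : ∀ {x} → Span P x → Span P (- x)
    Span-neg x∈ = resp (con-neg _) (scale (K.- K.1#) x∈)

    Span-sign : ∀ n {x} → Span P x → Span P ([-1]^ n · x)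
    Span-sign zero    x∈ = x∈
    Span-sign (suc n) x∈ = Span-neg (Span-sign n x∈)

    Span-∑ : ∀ {n} {f : Fin n → B} → (∀ i → Span P (f i)) → Span P (sum f)
    Span-∑ {zero}  f∈ = zero
    Span-∑ {suc n} f∈ = add (f∈ zero) (Span-∑ (f∈ ∘ suc))

    Span-* : ∀ {q} {Q : B → Set q} y → (∀ {x} → P x → Span Q (y * x)) → ∀ {x} → Span P x → Span Q (y * x)
    Span-* y f (generator x∈) = f x∈
    Span-* y f zero           = resp (sym (zeroʳ y)) zero
    Span-* y f (add x∈ x∈′)   = resp (sym (distribˡ y _ _)) (add (Span-* y f x∈) (Span-* y f x∈′))
    Span-* y f (scale a x∈)   = resp (trans (sym (*-assoc _ _ _)) (trans (*-congʳ (*-comm _ _)) (*-assoc _ _ _)))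
                                     (scale a (Span-* y f x∈))
    Span-* y f (resp eq x∈)   = resp (*-congˡ eq) (Span-* y f x∈)

    Span-map : ∀ {q} {Q : B → Set q} → (∀ {x} → P x → Span Q x) → ∀ {x} → Span P x → Span Q x
    Span-map f x∈ = resp (*-identityˡ _) (Span-* 1# (λ x∈ → resp (sym (*-identityˡ _)) (f x∈)) x∈)

  -- The factor J_0 = 1 counts towards `l`, so a product of l nonvanishing entries has exactly l
  -- factors; the weight is only an upper bound.
  data Monomial : ℕ → ℤ → B → Set c where
    one  : ∀ {e} → 0ℤ ℤ.≤ e → Monomial 0 e 1#
    J∙   : ∀ {l e d x} n → + n ℤ.+ e ℤ.≤ d → Monomial l e x → Monomial (suc l) d (J (+ n) * x)

  -- Zero parts pad the partition to `l` parts, to match the factors J_0 of a monomial.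
  data Character (l : ℕ) (e : ℤ) : B → Set c where
    character : ∀ {α} → IsPartition α → length α ≡ l → + sumℕ α ℤ.≤ e → Character l e (s ⌜ α ⌝)

  -- Polynomials in the J_a, homogeneous of degree l in them, and of degree
  -- at most e when J_a has degree a.
  U : ℕ → ℤ → B → Set (c Level.⊔ ℓ)
  U l e = Span (Monomial l e)

  V : ℕ → ℤ → B → Set (c Level.⊔ ℓ)
  V l e = Span (Character l e)

  Monomial-degree : ∀ {l e x} → Monomial l e x → 0ℤ ℤ.≤ e
  Monomial-degree (one 0≤e)   = 0≤e
  Monomial-degree (J∙ n le m) = ℤ.≤-trans (ℤ.+-mono-≤ (ℤ.+≤+ {n = n} ℕ.z≤n) (Monomial-degree m)) le

  U-weaken : ∀ {l e d x} → e ℤ.≤ d → U l e x → U l d x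
  U-weaken e≤d = Span-map λ where
    (one 0≤e)   → generator (one (ℤ.≤-trans 0≤e e≤d))
    (J∙ n le m) → generator (J∙ n (ℤ.≤-trans le e≤d) m)

  V-weaken : ∀ {l e d x} → e ℤ.≤ d → V l e x → V l d x
  V-weaken e≤d = Span-map λ where (character α↘ l≡ le) → generator (character α↘ l≡ (ℤ.≤-trans le e≤d))

  -- The effect on U of multiplication by a linear combination of the J_a, a ≤ d.
  record E (d : ℤ) (x : B) : Set (c Level.⊔ ℓ) where
    constructor multiplier
    field multiply : ∀ {l e y} → U l e y → U (suc l) (d ℤ.+ e) (x * y)
  open E

  E-resp : ∀ {d x y} → x ≈ y → E d x → E d y
  E-resp x≈y x∈ .multiply y∈ = resp (*-congʳ x≈y) (x∈ .multiply y∈)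

  E-weaken : ∀ {d d′ x} → d ℤ.≤ d′ → E d x → E d′ x
  E-weaken d≤d′ x∈ .multiply {e = e} y∈ = U-weaken (ℤ.+-monoˡ-≤ e d≤d′) (x∈ .multiply y∈)

  E-+ : ∀ {d x y} → E d x → E d y → E d (x + y)
  E-+ x∈ y∈ .multiply z∈ = resp (sym (distribʳ _ _ _)) (add (x∈ .multiply z∈) (y∈ .multiply z∈))

  E-neg : ∀ {d x} → E d x → E d (- x)
  E-neg x∈ .multiply y∈ = resp (-‿distribˡ-* _ _) (Span-neg (x∈ .multiply y∈))

  E-J : ∀ a → E a (J a)
  E-J (+ n)    .multiply = Span-* (J (+ n)) λ m → generator (J∙ n ℤ.≤-refl m)
  E-J -[1+ n ] .multiply y∈ = resp (sym (zeroˡ _)) zero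

  E-h : ∀ r a → E (a ℤ.+ + r) (h⟨ + r ⟩ a)
  E-h zero    a = E-J (a ℤ.+ 0ℤ)
  E-h (suc r) a = E-+ (E-J (a ℤ.+ + suc r)) (E-weaken (ℤ.+-monoʳ-≤ a ℤ.-≤+) (E-J (a ℤ.- + suc r)))

  private
    minor-degree : ∀ {n} (r c : Fin (suc n) → ℤ) k →
      (r zero ℤ.+ c k) ℤ.+ (∑ℤ (r ∘ suc) ℤ.+ ∑ℤ (c ∘ punchIn k)) ≡ ∑ℤ r ℤ.+ ∑ℤ c
    minor-degree r c k = ≡.trans (lemma (r zero) (c k) (∑ℤ (r ∘ suc)) (∑ℤ (c ∘ punchIn k))) (≡.cong (λ x → ∑ℤ r ℤ.+ x) (≡.sym (ℤΣ.sum-remove {i = k} c)))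
      where
      lemma : ∀ a b c d → (a ℤ.+ b) ℤ.+ (c ℤ.+ d) ≡ (a ℤ.+ c) ℤ.+ (b ℤ.+ d)
      lemma = solve-∀

  -- When entry (i , j) has weight r_i + c_j, the product along any permutation has the weight Σ r +
  -- Σ c.
  det-degree : ∀ {n} (M : Fin n → Fin n → B) (r c : Fin n → ℤ) →
    (∀ i j → E (r i ℤ.+ c j) (M i j)) → U n (∑ℤ r ℤ.+ ∑ℤ c) (det M)
  det-degree {zero}  M r c M∈ = generator (one ℤ.≤-refl)
  det-degree {suc n} M r c M∈ = Span-∑ {f = λ k → [-1]^ toℕ k · (M zero k * det (λ i j → M (suc i) (punchIn k j)))} λ k →
    Span-sign (toℕ k) (U-weaken (ℤ.≤-reflexive (minor-degree r c k))
      (M∈ zero k .multiply (det-degree _ (r ∘ suc) (c ∘ punchIn k) λ i j → M∈ (suc i) (punchIn k j))))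

  -- Telescoping a x - a′ x′ = (a - a′) x + a′ (x - x′) in each term of the expansion leaves one
  -- difference per summand, and each difference lowers the weight by 1.
  det-degree-difference : ∀ {n} (M M′ : Fin n → Fin n → B) (r c : Fin n → ℤ) →
    (∀ i j → E (r i ℤ.+ c j) (M i j)) → (∀ i j → E (r i ℤ.+ c j) (M′ i j)) →
    (∀ i j → E (r i ℤ.+ c j ℤ.- 1ℤ) (M i j - M′ i j)) →
    U n (∑ℤ r ℤ.+ ∑ℤ c ℤ.- 1ℤ) (det M - det M′)
  det-degree-difference {zero}  M M′ r c M∈ M′∈ Δ∈ = resp (sym (-‿inverseʳ 1#)) zero
  det-degree-difference {suc n} M M′ r c M∈ M′∈ Δ∈ =
    resp (trans (∑-distrib-+ {suc n} (term M) (λ k → - term M′ k)) (+-congˡ (sym (sign-∑ 1 (term M′)))))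
      (Span-∑ {f = λ k → term M k - term M′ k} λ k → resp (split k) (Span-sign (toℕ k) (add
        (U-weaken (ℤ.≤-reflexive (≡.trans (lemmaˡ (r zero ℤ.+ c k) (∑ℤ (r ∘ suc) ℤ.+ ∑ℤ (c ∘ punchIn k))) (≡.cong (ℤ._- 1ℤ) (minor-degree r c k))))
          (Δ∈ zero k .multiply (det-degree _ (r ∘ suc) (c ∘ punchIn k) λ i j → M∈ (suc i) (punchIn k j))))
        (U-weaken (ℤ.≤-reflexive (≡.trans (lemmaʳ (r zero ℤ.+ c k) (∑ℤ (r ∘ suc) ℤ.+ ∑ℤ (c ∘ punchIn k))) (≡.cong (ℤ._- 1ℤ) (minor-degree r c k))))
          (M′∈ zero k .multiply (det-degree-difference _ _ (r ∘ suc) (c ∘ punchIn k)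
            (λ i j → M∈ (suc i) (punchIn k j)) (λ i j → M′∈ (suc i) (punchIn k j))
            (λ i j → Δ∈ (suc i) (punchIn k j))))))))
    where
    minor : (Fin (suc n) → Fin (suc n) → B) → Fin (suc n) → B
    minor M k = det (λ i j → M (suc i) (punchIn k j))
    term : (Fin (suc n) → Fin (suc n) → B) → Fin (suc n) → B
    term M k = [-1]^ toℕ k · (M zero k * minor M k)
    lemmaˡ : ∀ a b → (a ℤ.- 1ℤ) ℤ.+ b ≡ (a ℤ.+ b) ℤ.- 1ℤ
    lemmaˡ = solve-∀
    lemmaʳ : ∀ a b → a ℤ.+ (b ℤ.- 1ℤ) ≡ (a ℤ.+ b) ℤ.- 1ℤ
    lemmaʳ = solve-∀
    telescope : ∀ a a′ x x′ → (a - a′) * x + a′ * (x - x′) ≈ a * x - a′ * x′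
    telescope a a′ x x′ = begin
      (a - a′) * x + a′ * (x - x′)
        ≈⟨ +-cong (distribʳ _ _ _) (distribˡ _ _ _) ⟩
      (a * x + - a′ * x) + (a′ * x + a′ * - x′)
        ≈⟨ trans (+-assoc _ _ _) (+-congˡ (sym (+-assoc _ _ _))) ⟩
      a * x + ((- a′ * x + a′ * x) + a′ * - x′)
        ≈⟨ +-congˡ (+-congʳ (trans (+-congʳ (sym (-‿distribˡ-* _ _))) (-‿inverseˡ _))) ⟩
      a * x + (0# + a′ * - x′)
        ≈⟨ +-congˡ (trans (+-identityˡ _) (sym (-‿distribʳ-* _ _))) ⟩
      a * x - a′ * x′ ∎
    split : ∀ k → [-1]^ toℕ k · ((M zero k - M′ zero k) * minor M k + M′ zero k * (minor M k - minor M′ k))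
              ≈ term M k - term M′ k
    split k = trans (sign-cong (toℕ k) (telescope _ _ _ _))
      (trans (sign-∙ (toℕ k) _ _) (+-congˡ (sign-⁻¹ (toℕ k) _)))

  private
    degree-rows : ∀ α → + sumℕ α ≡ ∑ℤ {length α} (λ i → part ⌜ α ⌝ (toℕ i))
    degree-rows []      = ≡.refl
    degree-rows (a ∷ α) = ≡.cong (λ x → + a ℤ.+ x) (degree-rows α)

    row : ∀ α → Fin (length α) → ℤ
    row α i = part ⌜ α ⌝ (toℕ i) ℤ.- + suc (toℕ i)

    ∑suc : ℕ → ℤ
    ∑suc l = ∑ℤ {l} (λ i → + suc (toℕ i))

    row+suc : ∀ α → ∑ℤ (row α) ℤ.+ ∑suc (length α) ≡ + sumℕ α
    row+suc α = ≡.trans (≡.sym (ℤΣ.∑-distrib-+ (row α) (λ i → + suc (toℕ i))))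
      (≡.trans (ℤΣ.sum-cong-≗ {length α} (λ i → lemma (part ⌜ α ⌝ (toℕ i)) (+ suc (toℕ i)))) (≡.sym (degree-rows α)))
      where
      lemma : ∀ a b → (a ℤ.- b) ℤ.+ b ≡ a
      lemma = solve-∀

    -- The row weights add up to |α| - (1 + ... + l), and the columns 0, ..., l without p to 1 + ...
    -- + l - p.
    omitColumn-weight : ∀ α p →
      ∑ℤ (row α) ℤ.+ ∑ℤ {length α} (λ j → + toℕ (punchIn p j)) ≡ + sumℕ α ℤ.- + toℕ p
    omitColumn-weight α p = lemma (∑ℤ (row α)) (+ toℕ p) (∑ℤ {length α} (λ j → + toℕ (punchIn p j))) (+ sumℕ α)
      (≡.trans (≡.cong (λ x → ∑ℤ (row α) ℤ.+ x) (≡.sym columns)) (row+suc α))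
      where
      columns : ∑suc (length α) ≡ + toℕ p ℤ.+ ∑ℤ {length α} (λ j → + toℕ (punchIn p j))
      columns = ≡.trans (≡.sym (ℤ.+-identityˡ _)) (ℤΣ.sum-remove {length α} {p} (λ j → + toℕ j))
      ring-lemma : ∀ a p x → a ℤ.+ x ≡ (a ℤ.+ (p ℤ.+ x)) ℤ.- p
      ring-lemma = solve-∀
      lemma : ∀ a p x d → a ℤ.+ (p ℤ.+ x) ≡ d → a ℤ.+ x ≡ d ℤ.- p
      lemma a p x d eq = ≡.trans (ring-lemma a p x) (≡.cong (ℤ._- p) eq)

  omitColumn-degree : ∀ α p → U (length α) (+ sumℕ α ℤ.- + toℕ p) (omitColumn α p)
  omitColumn-degree α p = ≡.subst (λ e → U (length α) e (omitColumn α p)) (omitColumn-weight α p)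
    (det-degree _ (row α) (λ j → + toℕ (punchIn p j)) λ i j → E-h (toℕ (punchIn p j)) (row α i))

  private
    shifted-entry : ∀ x j → E (x ℤ.- 1ℤ ℤ.+ + suc j) (h⟨ + j ⟩ x)
    shifted-entry x j = ≡.subst (λ d → E d (h⟨ + j ⟩ x)) (lemma x (+ j)) (E-h j x)
      where
      lemma : ∀ x j → x ℤ.+ j ≡ x ℤ.- 1ℤ ℤ.+ (1ℤ ℤ.+ j)
      lemma = solve-∀

    -- The leading terms J_{x+j} cancel. What remains is J_{x-j-2} - J_{x-j} for j > 0 and J_{x-2}
    -- for j = 0. The exception at j = 0 matters: a reflected term J_x would exceed the bound, but
    -- h^{(0)} has a single term.
    entry-difference : ∀ x j → E (x ℤ.- 1ℤ ℤ.+ + suc j ℤ.- 1ℤ) (h⟨ + suc j ⟩ (x ℤ.- 1ℤ) - h⟨ + j ⟩ x)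
    entry-difference x j = E-resp (cancel j) (E-+ low (rest j))
      where
      same : ∀ x j → x ℤ.- 1ℤ ℤ.+ (1ℤ ℤ.+ j) ≡ x ℤ.+ j
      same = solve-∀
      low : E (x ℤ.- 1ℤ ℤ.+ + suc j ℤ.- 1ℤ) (J (x ℤ.- 1ℤ ℤ.- + suc j))
      low = E-weaken (i≤j-from-difference (suc (j ℕ.+ j)) (lemma x (+ j))) (E-J (x ℤ.- 1ℤ ℤ.- + suc j))
        where
        lemma : ∀ x j → x ℤ.- 1ℤ ℤ.+ (1ℤ ℤ.+ j) ℤ.- 1ℤ ≡ x ℤ.- 1ℤ ℤ.- (1ℤ ℤ.+ j) ℤ.+ (1ℤ ℤ.+ (j ℤ.+ j))
        lemma = solve-∀
      reflected : ℕ → B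
      reflected zero    = 0#
      reflected (suc j) = - J (x ℤ.- + suc j)
      rest : ∀ j → E (x ℤ.- 1ℤ ℤ.+ + suc j ℤ.- 1ℤ) (reflected j)
      rest zero    .E.multiply y∈ = resp (sym (zeroˡ _)) zero
      rest (suc j) = E-neg (E-weaken (i≤j-from-difference (suc (j ℕ.+ j)) (lemma x (+ j))) (E-J (x ℤ.- + suc j)))
        where
        lemma : ∀ x j → x ℤ.- 1ℤ ℤ.+ (1ℤ ℤ.+ (1ℤ ℤ.+ j)) ℤ.- 1ℤ ≡ x ℤ.- (1ℤ ℤ.+ j) ℤ.+ (1ℤ ℤ.+ (j ℤ.+ j))
        lemma = solve-∀
      telescope : ∀ a b {c d} → c ≈ a → (c + b) - (a + d) ≈ b - d
      telescope a b {c} {d} c≈a = begin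
        (c + b) - (a + d)         ≈⟨ +-cong (trans (+-congʳ c≈a) (+-comm a b)) (sym (-‿+-comm a d)) ⟩
        (b + a) + (- a - d)       ≈⟨ trans (+-assoc _ _ _) (+-congˡ (sym (+-assoc _ _ _))) ⟩
        b + ((a - a) - d)         ≈⟨ +-congˡ (trans (+-congʳ (-‿inverseʳ a)) (+-identityˡ _)) ⟩
        b - d                     ∎
      cancel : ∀ j → J (x ℤ.- 1ℤ ℤ.- + suc j) + reflected j ≈ h⟨ + suc j ⟩ (x ℤ.- 1ℤ) - h⟨ + j ⟩ x
      cancel zero    = sym (trans (+-congˡ (-‿cong (sym (+-identityʳ _))))
        (trans (telescope _ _ (reflexive (≡.cong J (same x 0ℤ)))) (+-congˡ -0#≈0#)))
      cancel (suc j) = sym (telescope _ _ (reflexive (≡.cong J (same x (+ suc j)))))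

  -- Without column 0 the entries are h^{(j+1)}_{x-1} where s_α has h^{(j)}_x, so the two
  -- determinants agree in the top weight.
  omitColumn-zero : ∀ α → U (length α) (+ sumℕ α ℤ.- 1ℤ) (omitColumn α zero - s ⌜ α ⌝)
  omitColumn-zero α = ≡.subst₂ (λ e x → U (length α) e (omitColumn α zero - x))
    (≡.cong (ℤ._- 1ℤ) (row+suc α)) (≡.sym (s-partition α))
    (det-degree-difference _ _ (row α) (λ j → + suc (toℕ j))
      (λ i j → E-h (suc (toℕ j)) (row α i))
      (λ i j → ≡.subst (λ r → E (r ℤ.+ + suc (toℕ j)) (h⟨ + toℕ j ⟩ (x i))) (row′ i) (shifted-entry (x i) (toℕ j)))
      (λ i j → ≡.subst (λ r → E (r ℤ.+ + suc (toℕ j) ℤ.- 1ℤ) (h⟨ + suc (toℕ j) ⟩ r - h⟨ + toℕ j ⟩ (x i))) (row′ i)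
        (entry-difference (x i) (toℕ j))))
    where
    x : Fin (length α) → ℤ
    x i = part ⌜ α ⌝ (toℕ i) ℤ.- + toℕ i
    lemma : ∀ a i → a ℤ.- i ℤ.- 1ℤ ≡ a ℤ.- (1ℤ ℤ.+ i)
    lemma = solve-∀
    row′ : ∀ i → x i ℤ.- 1ℤ ≡ row α i
    row′ i = lemma (part ⌜ α ⌝ (toℕ i)) (+ toℕ i)

  -- Induction on the weight of the second factor

  private
    -- Only the weight of `y` is bounded: the expansions raise the index of the first factor, so `a`
    -- has to be arbitrary.
    Steps : ℕ → ℤ → Set _
    Steps l k = ∀ e → e ℤ.< k → ∀ a {y} → U l e y → V (suc l) (a ℤ.+ e) (J a * y)

    h-step : ∀ {l k} → Steps l k → ∀ r a {e y} → e ℤ.< k → U l e y → V (suc l) (a ℤ.+ + r ℤ.+ e) (h⟨ + r ⟩ a * y)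
    h-step step zero    a {e} e<k y∈ = step e e<k (a ℤ.+ 0ℤ) y∈
    h-step step (suc r) a {e} e<k y∈ = resp (sym (distribʳ _ _ _)) (add (step e e<k (a ℤ.+ + suc r) y∈)
      (V-weaken (ℤ.+-monoˡ-≤ e (ℤ.+-monoʳ-≤ a ℤ.-≤+)) (step e e<k (a ℤ.- + suc r) y∈)))

    pred-< : ∀ {a e k} → a ℤ.≤ e → e ℤ.< 1ℤ ℤ.+ k → ∀ r → a ℤ.- (1ℤ ℤ.+ + r) ℤ.< k
    pred-< {a} {e} {k} a≤e e<k r = ℤ.≤-<-trans
      (ℤ.≤-trans (i≤j-from-difference r (lemma a (+ r))) (ℤ.+-monoˡ-≤ -1ℤ a≤e))
      (ℤ.<-≤-trans (ℤ.+-monoˡ-< -1ℤ e<k) (ℤ.≤-reflexive (lemma′ k)))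
      where
      lemma : ∀ a r → a ℤ.- 1ℤ ≡ a ℤ.- (1ℤ ℤ.+ r) ℤ.+ r
      lemma = solve-∀
      lemma′ : ∀ k → 1ℤ ℤ.+ k ℤ.- 1ℤ ≡ k
      lemma′ = solve-∀

    -- The term p = 0 of the expansion of s_(n,α) is J_n s_α up to terms to
    -- which the induction hypothesis applies.
    prepend : ∀ {l k e} → Steps l k → ∀ n α → IsPartition (n ∷ α) → length α ≡ l →
              + sumℕ α ℤ.≤ e → e ℤ.< 1ℤ ℤ.+ k → V (suc l) (+ n ℤ.+ e) (J (+ n) * s ⌜ α ⌝)
    prepend {e = e} step n α n∷α↘ ≡.refl le e<k = resp rearrange (add (add
        (generator (character n∷α↘ ≡.refl (ℤ.+-monoʳ-≤ (+ n) le)))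
        -- The minor without column p > 0 loses weight p, which brings it under the induction
        -- hypothesis; h^{(p)}_n gives the p back, so the total stays within n + |α|.
        (Span-neg (Span-∑ {f = λ p → [-1]^ suc (toℕ p) · (h⟨ + suc (toℕ p) ⟩ (+ n) * omitColumn α (suc p))} λ p →
          Span-sign (suc (toℕ p)) (V-weaken (ℤ.≤-trans (ℤ.≤-reflexive (lemma (+ n) (+ suc (toℕ p)) (+ sumℕ α)))
              (ℤ.+-monoʳ-≤ (+ n) le))
            (h-step step (suc (toℕ p)) (+ n) (pred-< le e<k (toℕ p)) (omitColumn-degree α (suc p)))))))
        (Span-neg (V-weaken (ℤ.+-monoʳ-≤ (+ n) (ℤ.≤-trans (ℤ.+-monoʳ-≤ (+ sumℕ α) ℤ.-≤+) (ℤ.≤-trans (ℤ.≤-reflexive (ℤ.+-identityʳ _)) le)))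
          (step _ (pred-< le e<k 0) (+ n) (omitColumn-zero α)))))
      where
      lemma : ∀ n p d → n ℤ.+ p ℤ.+ (d ℤ.- p) ≡ n ℤ.+ d
      lemma = solve-∀
      tail-terms : B
      tail-terms = ∑[ p < length α ] ([-1]^ suc (toℕ p) · (h⟨ + suc (toℕ p) ⟩ (+ n) * omitColumn α (suc p)))
      rearrange : (s (+ n ∷ ⌜ α ⌝) - tail-terms) - J (+ n) * (omitColumn α zero - s ⌜ α ⌝) ≈ J (+ n) * s ⌜ α ⌝
      rearrange = begin
        (s (+ n ∷ ⌜ α ⌝) - tail-terms) - J (+ n) * (omitColumn α zero - s ⌜ α ⌝)
          ≈⟨ +-cong (trans (+-congʳ (trans (s-∷ (+ n) α) (+-congʳ (*-congʳ (h-zero (+ n)))))) (trans (+-assoc _ _ _)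
               (trans (+-congˡ (-‿inverseʳ _)) (+-identityʳ _))))
             (-‿cong (trans (distribˡ _ _ _) (+-congˡ (sym (-‿distribʳ-* _ _))))) ⟩
        J (+ n) * omitColumn α zero - (J (+ n) * omitColumn α zero - J (+ n) * s ⌜ α ⌝)
          ≈⟨ +-congˡ (trans (sym (-‿+-comm _ _)) (+-congˡ (-‿involutive _))) ⟩
        J (+ n) * omitColumn α zero + (- (J (+ n) * omitColumn α zero) + J (+ n) * s ⌜ α ⌝)
          ≈⟨ trans (sym (+-assoc _ _ _)) (trans (+-congʳ (-‿inverseʳ _)) (+-identityˡ _)) ⟩
        J (+ n) * s ⌜ α ⌝ ∎

    -- If n < q then J_n times a minor of the rows below q has degree less
    -- than q + |β|, so that the induction hypothesis applies to it.
    insert : ∀ {k e} n q β → Steps (suc (length β)) k → n ℕ.< q →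
             + sumℕ (q ∷ β) ℤ.≤ e → e ℤ.< 1ℤ ℤ.+ k → V (suc (suc (length β))) (+ n ℤ.+ e) (J (+ n) * s ⌜ q ∷ β ⌝)
    insert {k} {e} n q β step n<q le e<k = resp
      (sym (trans (*-congˡ (s-∷ (+ q) β)) (*-distribˡ-sum (J (+ n)) λ p → [-1]^ toℕ p · (h⟨ + toℕ p ⟩ (+ q) * omitColumn β p))))
      (Span-∑ {f = λ p → J (+ n) * ([-1]^ toℕ p · (h⟨ + toℕ p ⟩ (+ q) * omitColumn β p))} λ p →
        resp (trans (sign-cong (toℕ p) (trans (sym (*-assoc _ _ _)) (trans (*-congʳ (*-comm _ _)) (*-assoc _ _ _))))
                    (sym (sign-*ʳ (toℕ p) _ _)))
          (Span-sign (toℕ p) (V-weaken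
            (ℤ.≤-trans (ℤ.≤-reflexive (lemma (+ q) (+ toℕ p) (+ n) (+ sumℕ β))) (ℤ.+-monoʳ-≤ (+ n) le))
            (h-step step (toℕ p) (+ q) (below p) (E-J (+ n) .E.multiply (omitColumn-degree β p))))))
      where
      lemma : ∀ q p n b → q ℤ.+ p ℤ.+ (n ℤ.+ (b ℤ.- p)) ≡ n ℤ.+ (q ℤ.+ b)
      lemma = solve-∀
      below : ∀ p → + n ℤ.+ (+ sumℕ β ℤ.- + toℕ p) ℤ.< k
      below p = ℤ.≤-<-trans (i≤j-from-difference (toℕ p) (lemma₁ (+ n) (+ sumℕ β) (+ toℕ p)))
        (ℤ.<-≤-trans (ℤ.+-monoˡ-< (+ sumℕ β) (ℤ.+<+ n<q)) (ℤ.≤-trans le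
          (≡.subst₂ ℤ._≤_ (lemma₂ e) (lemma₂ k) (ℤ.+-monoʳ-≤ -1ℤ (ℤ.i<j⇒suc[i]≤j e<k)))))
        where
        lemma₁ : ∀ n b p → n ℤ.+ b ≡ n ℤ.+ (b ℤ.- p) ℤ.+ p
        lemma₁ = solve-∀
        lemma₂ : ∀ k → -1ℤ ℤ.+ (1ℤ ℤ.+ k) ≡ k
        lemma₂ = solve-∀

    -- The second factor is first rewritten in characters with `l` parts. Each of them is then
    -- multiplied by J_n, by `prepend` or `insert` according to whether n stays in front of the
    -- first part. At k = 0 nothing is left, as no monomial has negative weight.
    steps : ∀ l → (∀ {e x} → U l e x → V l e x) → ∀ k → Steps l (+ k)
    steps l U⊆V zero    e e<0 a = Span-* (J a) λ m → ⊥-elim (ℤ.<-irrefl ≡.refl (ℤ.≤-<-trans (Monomial-degree m) e<0))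
    steps l U⊆V (suc k) e e<k -[1+ n ] y∈ = resp (sym (zeroˡ _)) zero
    steps l U⊆V (suc k) e e<k (+ n)    y∈ = Span-* (J (+ n)) product (U⊆V y∈)
      where
      product : ∀ {x} → Character l e x → V (suc l) (+ n ℤ.+ e) (J (+ n) * x)
      product (character {[]} α↘ l≡ le) = prepend (steps l U⊆V k) n [] [-] l≡ le e<k
      product (character {q ∷ β} α↘ l≡ le) with q ℕ.≤? n
      ... | yes q≤n = prepend (steps l U⊆V k) n (q ∷ β) (q≤n ∷ α↘) l≡ le e<k
      product (character {q ∷ β} α↘ ≡.refl le) | no q≰n =
        insert n q β (steps l U⊆V k) (ℕ.≰⇒> q≰n) le e<k

  private
    i<1+∣i∣ : ∀ i → i ℤ.< + suc ∣ i ∣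
    i<1+∣i∣ (+ n)    = ℤ.+<+ (ℕ.n<1+n n)
    i<1+∣i∣ -[1+ n ] = ℤ.-<+

  -- Outer induction, on the number of factors. The bound `suc ∣ e ∣` merely exceeds the weight e of
  -- the factors after the first, so that the inner induction applies to them.
  U⊆V : ∀ l {e x} → U l e x → V l e x
  U⊆V zero    = Span-map λ where (one 0≤e) → generator (character [] ≡.refl 0≤e)
  U⊆V (suc l) = Span-map λ where
    (J∙ {e = e} n le m) → V-weaken le (steps l (U⊆V l) (suc ∣ e ∣) e (i<1+∣i∣ e) (+ n) (generator m))

  data IrreducibleCharacter : B → Set c where
    irreducible : ∀ {α} → IsPartition α → IrreducibleCharacter (s ⌜ α ⌝)

  -- A character is a determinant in the J_a and so lies in some `U`; multiplication by J_n adds one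
  -- factor, and `U⊆V` returns to characters.
  J-* : ∀ n {x} → Span IrreducibleCharacter x → Span IrreducibleCharacter (J (+ n) * x)
  J-* n = Span-* (J (+ n)) λ where
    (irreducible {α} α↘) → Span-map (λ where (character β↘ _ _) → generator (irreducible β↘))
      (U⊆V (suc (length α)) (≡.subst (U (suc (length α)) _) (≡.cong (λ x → J (+ n) * x) (≡.sym (s-partition α)))
        (E-J (+ n) .E.multiply (det-degree _ (λ i → part ⌜ α ⌝ (toℕ i) ℤ.- + toℕ i) (λ j → + toℕ j)
          λ i j → E-h (toℕ j) (part ⌜ α ⌝ (toℕ i) ℤ.- + toℕ i)))))

  -- In the orthogonal case J_n = h_n - h_{n-2} is solved recursively as h_n = J_n + h_{n-2}, ending
  -- at h_0 = 1 and h_1 = J_1.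
  h-* : ∀ {p} {P : B → Set p} 𝔤 → (∀ n {x} → Span P x → Span P (J₊ 𝔤 (suc n) * x)) →
        ∀ n {x} → Span P x → Span P (h (+ n) * x)
  h-* 𝔤          J-* zero          x∈ = resp (sym (*-identityˡ _)) x∈
  h-* symplectic J-* (suc n)       x∈ = J-* n x∈
  h-* orthogonal J-* (suc zero)    x∈ = resp (*-congʳ (trans (+-congˡ -0#≈0#) (+-identityʳ _))) (J-* 0 x∈)
  h-* orthogonal J-* (suc (suc n)) x∈ = resp (trans (sym (distribʳ _ _ _)) (*-congʳ
      (trans (+-assoc _ _ _) (trans (+-congˡ (-‿inverseˡ _)) (+-identityʳ _)))))
    (add (J-* (suc n) x∈) (h-* orthogonal J-* n x∈))

  -- For products of terms the stronger claim is proved that the span is stable under multiplication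
  -- by every `b`; it is then applied to the empty partition, whose character is 1.
  characters-span : ∀ b → Span IrreducibleCharacter b
  characters-span b = resp (*-identityʳ b) (go b (generator (irreducible [])))
    where
    go : ∀ b {x} → Span IrreducibleCharacter x → Span IrreducibleCharacter (b * x)
    go (con a)   x∈ = scale a x∈
    go (h₁₊ n)   x∈ = h-* 𝔤 (J-* ∘ suc) (suc n) x∈
    go (b₁ + b₂) x∈ = resp (sym (distribʳ _ _ _)) (add (go b₁ x∈) (go b₂ x∈))
    go (b₁ * b₂) x∈ = resp (sym (*-assoc _ _ _)) (go b₁ (go b₂ x∈))
    go (- b)     x∈ = resp (-‿distribˡ-* _ _) (Span-neg (go b x∈))

  -- Operators on 𝓑

  if-map : ∀ (φ : B → B) → φ 0# ≈ 0# → ∀ b x → φ (if b then x else 0#) ≈ (if b then φ x else 0#)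
  if-map φ φ0≈0 true  x = refl
  if-map φ φ0≈0 false x = φ0≈0

  z^-cong : ∀ {x y} m → x ≈ y → x z^ m ≋ y z^ m
  z^-cong {x} {y} m x≈y n = go (does (n ℤ.≟ m))
    where
    go : ∀ b → (if b then x else 0#) ≈ (if b then y else 0#)
    go true  = x≈y
    go false = refl

  z^-+ : ∀ m x y → (x + y) z^ m ≋ (x z^ m) M.+ᴹ (y z^ m)
  z^-+ m x y n = go (does (n ℤ.≟ m))
    where
    go : ∀ b → (if b then x + y else 0#) ≈ (if b then x else 0#) + (if b then y else 0#)
    go true  = refl
    go false = sym (+-identityˡ 0#)

  z^-0 : ∀ m → 0# z^ m ≋ M.0ᴹ
  z^-0 m n = sym (if-map (λ _ → 0#) refl (does (n ℤ.≟ m)) 0#)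

  z^-neg : ∀ m x → M.-ᴹ (x z^ m) ≋ (- x) z^ m
  z^-neg m x n = if-map -_ -0#≈0# (does (n ℤ.≟ m)) x

  z^-• : ∀ b m x → b • (x z^ m) ≋ (b * x) z^ m
  z^-• b m x n = if-map (λ x → b * x) (zeroʳ b) (does (n ℤ.≟ m)) x

  z^-extend : ∀ f m x → extend f (x z^ m) ≋ (f ⟨$⟩ x) z^ m
  z^-extend f m x n = if-map (f ⟨$⟩_) (LinearMap.0ᴹ-homo f) (does (n ℤ.≟ m)) x

  z^-sign : ∀ k m x → M.[-1]^ k · (x z^ m) ≋ ([-1]^ k · x) z^ m
  z^-sign zero    m x n = refl
  z^-sign (suc k) m x n = trans (-‿cong (z^-sign k m x n)) (z^-neg m ([-1]^ k · x) n)

  z^-shift : ∀ e m x → z^ e · (x z^ m) ≋ x z^ (m ℤ.+ e)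
  z^-shift e m x n = reflexive (≡.cong (if_then x else 0#)
    (does-⇔ (mk⇔ to from) (n ℤ.- e ℤ.≟ m) (n ℤ.≟ m ℤ.+ e)))
    where
    lemma₁ : ∀ n e → n ≡ n ℤ.- e ℤ.+ e
    lemma₁ = solve-∀
    lemma₂ : ∀ m e → m ℤ.+ e ℤ.- e ≡ m
    lemma₂ = solve-∀
    to : n ℤ.- e ≡ m → n ≡ m ℤ.+ e
    to ≡.refl = lemma₁ n e
    from : n ≡ m ℤ.+ e → n ℤ.- e ≡ m
    from ≡.refl = lemma₂ m e

  z^-constant : ∀ f k m x → constant (extend f) k (x z^ m) ≋ (if does (k ℤ.≟ 0ℤ) then f ⟨$⟩ x else 0#) z^ m
  z^-constant f k m x = go (does (k ℤ.≟ 0ℤ))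
    where
    go : ∀ b → (if b then extend f (x z^ m) else M.0ᴹ) ≋ (if b then f ⟨$⟩ x else 0#) z^ m
    go true    = z^-extend f m x
    go false n = sym (z^-0 m n)

  module z^-Sum m = SumHomomorphism +-commutativeMonoid M.+ᴹ-commutativeMonoid (_z^ m) (z^-cong m) (z^-0 m) (z^-+ m)

  -- The coefficients of an `OpSeries` are bare functions, so their linearity over the scalars is
  -- recorded separately from `LinearMap`.
  record IsLinear (T : 𝓑 → 𝓑) : Set (c Level.⊔ ℓ) where
    field
      cong  : ∀ {v w} → v ≋ w → T v ≋ T w
      +-hom : ∀ v w → T (v M.+ᴹ w) ≋ T v M.+ᴹ T w
      •-hom : ∀ a v → T (con a • v) ≋ con a • T v

  module _ where
    open IsLinear

    End-linear : ∀ (f : End 𝓑-module) → IsLinear (f ⟨$⟩_)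
    End-linear f .cong      = LinearMap.⟦⟧-cong f
    End-linear f .+-hom     = LinearMap.+ᴹ-homo f
    End-linear f .•-hom a v = LinearMap.*ₗ-homo f a v

    extend-linear : ∀ f → IsLinear (extend f)
    extend-linear f .cong v≋w n = LinearMap.⟦⟧-cong f (v≋w n)
    extend-linear f .+-hom v w n = LinearMap.+ᴹ-homo f (coeff v n) (coeff w n)
    extend-linear f .•-hom a v n = LinearMap.*ₗ-homo f a (coeff v n)

    z^-linear : ∀ e {T} → IsLinear T → IsLinear (λ v → z^ e · T v)
    z^-linear e T-lin .cong v≋w n  = T-lin .cong v≋w (n ℤ.- e)
    z^-linear e T-lin .+-hom v w n = T-lin .+-hom v w (n ℤ.- e)
    z^-linear e T-lin .•-hom a v n = T-lin .•-hom a v (n ℤ.- e)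

    •-linear : ∀ b {T} → IsLinear T → IsLinear (λ v → b • T v)
    •-linear b T-lin .cong v≋w n  = *-congˡ (T-lin .cong v≋w n)
    •-linear b T-lin .+-hom v w n = trans (*-congˡ (T-lin .+-hom v w n)) (distribˡ _ _ _)
    •-linear b T-lin .•-hom a v n = trans (*-congˡ (T-lin .•-hom a v n))
      (trans (sym (*-assoc _ _ _)) (trans (*-congʳ (*-comm _ _)) (*-assoc _ _ _)))

    0-linear : IsLinear (λ _ → M.0ᴹ)
    0-linear .cong _ n    = refl
    0-linear .+-hom _ _ n = sym (+-identityˡ 0#)
    0-linear .•-hom _ _ n = sym (zeroʳ _)

    +-linear : ∀ {S T} → IsLinear S → IsLinear T → IsLinear (λ v → S v M.+ᴹ T v)
    +-linear S-lin T-lin .cong v≋w n = +-cong (S-lin .cong v≋w n) (T-lin .cong v≋w n)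
    +-linear S-lin T-lin .+-hom v w n = trans (+-cong (S-lin .+-hom v w n) (T-lin .+-hom v w n)) (interchange _ _ _ _)
      where open CommutativeSemigroupProperties (CommutativeMonoid.commutativeSemigroup +-commutativeMonoid) using (interchange)
    +-linear S-lin T-lin .•-hom a v n = trans (+-cong (S-lin .•-hom a v n) (T-lin .•-hom a v n)) (sym (distribˡ _ _ _))

    neg-linear : ∀ {T} → IsLinear T → IsLinear (λ v → M.-ᴹ T v)
    neg-linear T-lin .cong v≋w n  = -‿cong (T-lin .cong v≋w n)
    neg-linear T-lin .+-hom v w n = trans (-‿cong (T-lin .+-hom v w n)) (sym (-‿+-comm _ _))
    neg-linear T-lin .•-hom a v n = trans (-‿cong (T-lin .•-hom a v n)) (-‿distribʳ-* _ _)

    sign-linear : ∀ k {T} → IsLinear T → IsLinear (λ v → M.[-1]^ k · T v)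
    sign-linear zero    T-lin = T-lin
    sign-linear (suc k) T-lin = neg-linear (sign-linear k T-lin)

    constant-linear : ∀ {T} → IsLinear T → ∀ k → IsLinear (constant T k)
    constant-linear {T} T-lin k = go (does (k ℤ.≟ 0ℤ))
      where
      go : ∀ b → IsLinear (λ v → if b then T v else M.0ᴹ)
      go true  = T-lin
      go false = 0-linear

    -- By recursion on the derivation in the span: scalars keep the bound of a finite sum, and a sum
    -- of two elements takes the larger of the two bounds.
    HasSum-extend : ∀ {T : ℤ → 𝓑 → 𝓑} {S} → (∀ k → IsLinear (T k)) → IsLinear S → ∀ m →
      (∀ α → IsPartition α → M.HasSumℤ (λ k → T k (s ⌜ α ⌝ z^ m)) (S (s ⌜ α ⌝ z^ m))) →
      ∀ b → M.HasSumℤ (λ k → T k (b z^ m)) (S (b z^ m))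
    HasSum-extend {T} {S} T-lin S-lin m on-basis b = go (characters-span b)
      where
      go : ∀ {x} → Span IrreducibleCharacter x → M.HasSumℤ (λ k → T k (x z^ m)) (S (x z^ m))
      go (generator (irreducible α↘)) = on-basis _ α↘
      go zero = M.HasSumℤ-cong {f = λ _ → M.0ᴹ} {g = λ k → T k (0# z^ m)} {x = M.0ᴹ} {y = S (0# z^ m)} (λ k → at-zero (T-lin k)) (at-zero S-lin)
        M.HasSumℤ-ε
        where
        at-zero : ∀ {R} → IsLinear R → M.0ᴹ ≋ R (0# z^ m)
        at-zero R-lin n = sym (trans (R-lin .cong 0≋ n) (trans (R-lin .•-hom K.0# (0# z^ m) n) (zeroˡ _)))
          where
          -- That zero goes to zero is read off from homogeneity, by writing zero as 0 times itself.
          0≋ : 0# z^ m ≋ con K.0# • (0# z^ m)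
          0≋ n = trans (z^-0 m n) (sym (zeroˡ _))
      go (add {x} {y} x∈ y∈) = M.HasSumℤ-cong
        {f = λ k → T k (x z^ m) M.+ᴹ T k (y z^ m)} {g = λ k → T k ((x + y) z^ m)}
        {x = S (x z^ m) M.+ᴹ S (y z^ m)} {y = S ((x + y) z^ m)}
        (λ k → split (T-lin k)) (split S-lin)
        (M.HasSumℤ-∙ {f = λ k → T k (x z^ m)} {g = λ k → T k (y z^ m)} {x = S (x z^ m)} {y = S (y z^ m)} (go x∈) (go y∈))
        where
        split : ∀ {R} → IsLinear R → R (x z^ m) M.+ᴹ R (y z^ m) ≋ R ((x + y) z^ m)
        split R-lin n = sym (trans (R-lin .cong (z^-+ m x y) n) (R-lin .+-hom (x z^ m) (y z^ m) n))
      go (scale a {x} x∈) = M.HasSumℤ-cong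
        {f = λ k → con a • T k (x z^ m)} {g = λ k → T k ((con a * x) z^ m)}
        {x = con a • S (x z^ m)} {y = S ((con a * x) z^ m)}
        (λ k → pull (T-lin k)) (pull S-lin) (HasSumℤ-map {f = λ k → T k (x z^ m)} {x = S (x z^ m)} (go x∈))
        where
        open SumHomomorphism M.+ᴹ-commutativeMonoid M.+ᴹ-commutativeMonoid (con a •_)
          (λ v≋w n → *-congˡ (v≋w n)) (λ n → zeroʳ (con a)) (λ v w n → distribˡ (con a) (coeff v n) (coeff w n))
        pull : ∀ {R} → IsLinear R → con a • R (x z^ m) ≋ R ((con a * x) z^ m)
        pull R-lin n = sym (trans (sym (R-lin .cong (z^-• (con a) m x) n)) (R-lin .•-hom a (x z^ m) n))
      go (resp {x} {y} x≈y x∈) = M.HasSumℤ-cong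
        {f = λ k → T k (x z^ m)} {g = λ k → T k (y z^ m)} {x = S (x z^ m)} {y = S (y z^ m)}
        (λ k → T-lin k .cong (z^-cong m x≈y)) (S-lin .cong (z^-cong m x≈y)) (go x∈)

  -- Creation operators

  module _ {D : ℤ → End B-module} (isD : IsLowerD D) where
    open IsLowerD isD

    DE-folded : OpSeries
    DE-folded = D[u] D [-u] ⊕ D[u] D [-u] [1/u] ⊖ constant (extend (D 0ℤ))

    DE-folded-linear : ∀ k → IsLinear (DE-folded k)
    DE-folded-linear k = +-linear
      (+-linear (sign-linear ∣ k ∣ (extend-linear (D k))) (sign-linear ∣ ℤ.- k ∣ (extend-linear (D (ℤ.- k)))))
      (neg-linear (constant-linear (extend-linear (D 0ℤ)) k))

    signedD : List ℕ → ℕ → B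
    signedD α p = [-1]^ p · (D (+ p) ⟨$⟩ s ⌜ α ⌝)

    signedD-outside : ∀ α → IsPartition α → ∀ {p} → length α ℕ.< p → signedD α p ≈ 0#
    signedD-outside α α↘ {p} l<p = trans (sign-cong p (outside α α↘ (+ p) (inj₂ (ℤ.+<+ l<p)))) (sign-ε p)

    DE-folded-value : ∀ α → IsPartition α → ∀ k m → DE-folded k (s ⌜ α ⌝ z^ m) ≋ signedD α ∣ k ∣ z^ m
    DE-folded-value α α↘ k m n = begin
      coeff (DE-folded k (σ z^ m)) n
        ≈⟨ +-cong (+-cong (part-value k n) (part-value (ℤ.- k) n))
             (trans (-‿cong (z^-constant (D 0ℤ) k m σ n)) (z^-neg m _ n)) ⟩
      coeff (x₁ z^ m) n + coeff (x₂ z^ m) n + coeff ((- x₃) z^ m) n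
        ≈⟨ trans (+-congʳ (sym (z^-+ m x₁ x₂ n))) (sym (z^-+ m (x₁ + x₂) (- x₃) n)) ⟩
      coeff ((x₁ + x₂ - x₃) z^ m) n
        ≈⟨ z^-cong m (fold k) n ⟩
      coeff (signedD α ∣ k ∣ z^ m) n ∎
      where
      σ = s ⌜ α ⌝
      signed : ℤ → B
      signed k = [-1]^ ∣ k ∣ · (D k ⟨$⟩ σ)
      x₁ = signed k
      x₂ = signed (ℤ.- k)
      x₃ = if does (k ℤ.≟ 0ℤ) then D 0ℤ ⟨$⟩ σ else 0#
      part-value : ∀ k → (D[u] D [-u]) k (σ z^ m) ≋ signed k z^ m
      part-value k n = trans (sign-extend ∣ k ∣ n) (z^-sign ∣ k ∣ m (D k ⟨$⟩ σ) n)
        where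
        open Alternating M.+ᴹ-abelianGroup using () renaming ([-1]^_·_ to signᴹ)
        sign-extend : ∀ p → signᴹ p (extend (D k) (σ z^ m)) ≋ signᴹ p ((D k ⟨$⟩ σ) z^ m)
        sign-extend zero    n = z^-extend (D k) m σ n
        sign-extend (suc p) n = -‿cong (sign-extend p n)
      negative : ∀ p → signed -[1+ p ] ≈ 0#
      negative p = trans (sign-cong (suc p) (outside α α↘ -[1+ p ] (inj₁ ℤ.-<+))) (sign-ε (suc p))
      fold : ∀ k → signed k + signed (ℤ.- k) - (if does (k ℤ.≟ 0ℤ) then D 0ℤ ⟨$⟩ σ else 0#) ≈ signedD α ∣ k ∣
      fold (+ zero)  = trans (+-assoc _ _ _) (trans (+-congˡ (-‿inverseʳ _)) (+-identityʳ _))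
      fold (+ suc p) = trans (+-cong (trans (+-congˡ (negative p)) (+-identityʳ _)) -0#≈0#) (+-identityʳ _)
      fold -[1+ p ]  = trans (+-cong (trans (+-congʳ (negative p)) (+-identityˡ _)) -0#≈0#) (+-identityʳ _)

    -- The terms t and -t share the factor `signedD α ∣ t ∣`, and their J's add up to h^{(∣t∣)}_n;
    -- the term t = 0 gives h^{(0)}_n = J_n. The result is the expansion of s_(n,α) along its first
    -- row.
    J∗signedD : ∀ α → IsPartition α → ∀ n → HasSumℤ (λ t → J (t ℤ.+ n) * signedD α ∣ t ∣) (s (n ∷ ⌜ α ⌝))
    J∗signedD α α↘ n = suc l , vanish , (begin
      (∑[ t < suc l ] (J (+ toℕ t ℤ.+ n) * signedD α (toℕ t))) + (∑[ t < suc l ] reflected (toℕ t))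
        -- The window reaches down to -(l + 1), where D_{l+1} vanishes; without that term t and -t
        -- pair off for t = 1, ..., l.
        ≈⟨ +-congˡ (∑-extend reflected (ℕ.n≤1+n l) (λ t l≤t → trans (*-congˡ (signedD-outside α α↘ (ℕ.s≤s l≤t))) (zeroʳ _))) ⟨
      (J (0ℤ ℤ.+ n) * signedD α 0 + (∑[ t < l ] direct (toℕ t))) + (∑[ t < l ] reflected (toℕ t))
        ≈⟨ trans (+-assoc _ _ _) (+-congˡ (sym (∑-distrib-+ {l} (direct ∘ toℕ) (reflected ∘ toℕ)))) ⟩
      J (0ℤ ℤ.+ n) * signedD α 0 + (∑[ t < l ] (direct (toℕ t) + reflected (toℕ t)))
        ≈⟨ +-cong (trans (*-cong (reflexive (≡.cong J (ℤ.+-comm 0ℤ n))) (minor α α↘ zero)) refl)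
             (sum-cong-≋ {l} column) ⟩
      (∑[ p < suc l ] ([-1]^ toℕ p · (h⟨ + toℕ p ⟩ n * omitColumn α p)))
        ≈⟨ s-∷ n α ⟨
      s (n ∷ ⌜ α ⌝) ∎)
      where
      l = length α
      direct reflected : ℕ → B
      direct t    = J (+ suc t ℤ.+ n) * signedD α (suc t)
      reflected t = J (-[1+ t ] ℤ.+ n) * signedD α (suc t)
      vanish : ∀ t → suc l ℕ.≤ ∣ t ∣ → J (t ℤ.+ n) * signedD α ∣ t ∣ ≈ 0#
      vanish t l<t = trans (*-congˡ (signedD-outside α α↘ l<t)) (zeroʳ _)
      column : ∀ t → direct (toℕ t) + reflected (toℕ t)
               ≈ [-1]^ suc (toℕ t) · (h⟨ + suc (toℕ t) ⟩ n * omitColumn α (suc t))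
      column t = trans (sym (distribʳ _ _ _)) (trans (sign-*ʳ (suc (toℕ t)) _ _)
        (sign-cong (suc (toℕ t)) (*-cong
          (+-cong (reflexive (≡.cong J (ℤ.+-comm (+ suc (toℕ t)) n))) (reflexive (≡.cong J (ℤ.+-comm -[1+ toℕ t ] n))))
          (minor α α↘ (suc t)))))

    creation : ∀ {ψ} → IsCreation ψ → ∀ m →
      Ψ[u] ψ ≐ (u^ m ℤ.+ 1ℤ z^ 1ℤ · J[u]) ∗ DE-folded on-z^ m B
    creation {ψ} isψ m k = HasSum-extend {T} {ψ k ⟨$⟩_}
      (λ t → z^-linear 1ℤ (•-linear (J (t ℤ.- (m ℤ.+ 1ℤ))) (DE-folded-linear (k ℤ.- t)))) (End-linear (ψ k)) m on-basis
      where
      T : ℤ → 𝓑 → 𝓑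
      T t v = z^ 1ℤ · (J (t ℤ.- (m ℤ.+ 1ℤ)) • DE-folded (k ℤ.- t) v)
      n = k ℤ.- m ℤ.- 1ℤ
      lemma : ∀ k m t → t ℤ.+ ℤ.- k ℤ.+ (k ℤ.- m ℤ.- 1ℤ) ≡ t ℤ.- (m ℤ.+ 1ℤ)
      lemma = solve-∀
      on-basis : ∀ α → IsPartition α → M.HasSumℤ (λ t → T t (s ⌜ α ⌝ z^ m)) (ψ k ⟨$⟩ (s ⌜ α ⌝ z^ m))
      on-basis α α↘ = M.HasSumℤ-cong
        {f = λ t → f t z^ (m ℤ.+ 1ℤ)} {g = λ t → T t (s ⌜ α ⌝ z^ m)}
        {x = s (n ∷ ⌜ α ⌝) z^ (m ℤ.+ 1ℤ)} {y = ψ k ⟨$⟩ (s ⌜ α ⌝ z^ m)}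
        term (λ i → sym (isψ k m α α↘ i))
        -- Centring the sum at t = k makes it symmetric: with n = k - m - 1, the index t - (m + 1)
        -- of J is (t - k) + n.
        (z^-Sum.HasSumℤ-map (m ℤ.+ 1ℤ) (HasSumℤ-shift (ℤ.- k) (J∗signedD α α↘ n)))
        where
        f : ℤ → B
        f t = J (t ℤ.+ ℤ.- k ℤ.+ n) * signedD α ∣ t ℤ.+ ℤ.- k ∣
        term : ∀ t → f t z^ (m ℤ.+ 1ℤ) ≋ T t (s ⌜ α ⌝ z^ m)
        term t i = begin
          coeff (f t z^ (m ℤ.+ 1ℤ)) i
            ≈⟨ z^-cong (m ℤ.+ 1ℤ) (*-cong (reflexive (≡.cong J (lemma k m t)))
                 (reflexive (≡.cong (signedD α) (ℤ.∣i-j∣≡∣j-i∣ t k)))) i ⟩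
          coeff ((a * signedD α ∣ k ℤ.- t ∣) z^ (m ℤ.+ 1ℤ)) i
            ≈⟨ z^-shift 1ℤ m (a * signedD α ∣ k ℤ.- t ∣) i ⟨
          coeff ((a * signedD α ∣ k ℤ.- t ∣) z^ m) (i ℤ.- 1ℤ)
            ≈⟨ z^-• a m (signedD α ∣ k ℤ.- t ∣) (i ℤ.- 1ℤ) ⟨
          a * coeff (signedD α ∣ k ℤ.- t ∣ z^ m) (i ℤ.- 1ℤ)
            ≈⟨ *-congˡ (DE-folded-value α α↘ (k ℤ.- t) m (i ℤ.- 1ℤ)) ⟨
          coeff (T t (s ⌜ α ⌝ z^ m)) i ∎
          where a = J (t ℤ.- (m ℤ.+ 1ℤ))

  -- Annihilation operators

  signedRemove : List ℕ → ℕ → B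
  signedRemove α t = [-1]^ t · s (remove t ⌜ α ⌝)

  -- Beyond the length the shifted part is 1 - t, and 1 - t + r < 0 as soon as t ≥ r + 2; the bound
  -- on t secures both conditions.
  shiftedPart-negative : ∀ α r {t} → length α ℕ.+ suc (suc r) ℕ.≤ t → shiftedPart ⌜ α ⌝ t ℤ.+ + r ℤ.< 0ℤ
  shiftedPart-negative α r {t} le = ≡.subst (λ x → x ℤ.- + t ℤ.+ 1ℤ ℤ.+ + r ℤ.< 0ℤ)
    (≡.sym (part-beyond ⌜ α ⌝ (ℕ.≤-trans (ℕ.≤-reflexive (length-map +_ α)) (ℕ.m+n≤o⇒m≤o (length α) le))))
    (ℤ.≤-<-trans (ℤ.≤-trans (ℤ.≤-reflexive (lemma₁ (+ t) (+ r)))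
      (ℤ.+-monoʳ-≤ (1ℤ ℤ.+ + r) (ℤ.neg-mono-≤ (ℤ.+≤+ (ℕ.m+n≤o⇒n≤o (length α) le)))))
      (≡.subst (ℤ._< 0ℤ) (lemma₂ (+ r)) ℤ.-<+))
    where
    lemma₁ : ∀ t r → 0ℤ ℤ.- t ℤ.+ 1ℤ ℤ.+ r ≡ (1ℤ ℤ.+ r) ℤ.- t
    lemma₁ = solve-∀
    lemma₂ : ∀ r → -1ℤ ≡ (1ℤ ℤ.+ r) ℤ.- (1ℤ ℤ.+ (1ℤ ℤ.+ r))
    lemma₂ = solve-∀

  -- For p ≥ 0 the sum is the expansion of a determinant whose column p is
  -- repeated.
  upper-vanishes : ∀ α r → HasSumℕ (λ t → h⟨ + r ⟩ (shiftedPart ⌜ α ⌝ t) * signedRemove α t) 0#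
  upper-vanishes α r = suc M ,
    (λ t M<t → trans (*-congʳ (h-vanishes r (shiftedPart-negative α r (ℕ.<⇒≤ M<t)))) (zeroˡ _)) ,
    trans (sum-cong-≋ {suc M} term) (laplace-repeated N q)
    where
    -- This size is at least `length α`, so the determinants are stable; it exceeds r, so column r
    -- is present; and all rows beyond it vanish in that column.
    M = length α ℕ.+ suc (suc r)
    N : Fin (suc M) → Fin M → B
    N t j = h⟨ + toℕ j ⟩ (shiftedPart ⌜ α ⌝ (toℕ t))
    r<M : r ℕ.< M
    r<M = ℕ.≤-trans (ℕ.n≤1+n _) (ℕ.m≤n+m (suc (suc r)) (length α))
    q = fromℕ< r<M
    term : ∀ t → h⟨ + r ⟩ (shiftedPart ⌜ α ⌝ (toℕ t)) * signedRemove α (toℕ t)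
                 ≈ [-1]^ toℕ t · (N t q * det (λ i → N (punchIn t i)))
    term t = trans (sign-*ʳ (toℕ t) _ _) (sign-cong (toℕ t) (*-cong
      (reflexive (≡.cong (λ r → h⟨ + r ⟩ (shiftedPart ⌜ α ⌝ (toℕ t))) (≡.sym (toℕ-fromℕ< r<M))))
      (trans (sym (jacobiTrudi-stable (remove (toℕ t) ⌜ α ⌝) (length-remove ⌜ α ⌝ (ℕ.≤-pred (toℕ<n t))
          (ℕ.≤-trans (ℕ.≤-reflexive (length-map +_ α)) (ℕ.m≤m+n (length α) (suc (suc r)))))))
        (det-cong {M} λ i j → reflexive (≡.cong h⟨ + toℕ j ⟩ (part-remove ⌜ α ⌝ t i))))))

  -- The inverse series of J(u)

  -- The coefficients of J(u)⁻¹ are stored in decreasing order, so the head of the list is the last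
  -- term, t = n, of the Cauchy product.
  convolve-sum : ∀ i n → let (x , xs) = inverseUpTo n in
    convolve i (x ∷ xs) ≈ ∑[ t < suc n ] (J⁻¹ (+ toℕ t) * J (+ i ℤ.+ (+ n ℤ.- + toℕ t)))
  convolve-sum i zero    = +-congʳ (trans (*-comm _ _) (*-congˡ (reflexive (≡.cong J (≡.sym (ℤ.+-identityʳ (+ i)))))))
  convolve-sum i (suc n) = begin
    J (+ i) * J⁻¹ (+ suc n) + convolve (suc i) (proj₁ (inverseUpTo n) ∷ proj₂ (inverseUpTo n))
      ≈⟨ +-cong (*-comm _ _) (convolve-sum (suc i) n) ⟩
    J⁻¹ (+ suc n) * J (+ i) + (∑[ t < suc n ] (J⁻¹ (+ toℕ t) * J (+ suc i ℤ.+ (+ n ℤ.- + toℕ t))))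
      ≈⟨ +-comm _ _ ⟩
    (∑[ t < suc n ] (J⁻¹ (+ toℕ t) * J (+ suc i ℤ.+ (+ n ℤ.- + toℕ t)))) + J⁻¹ (+ suc n) * J (+ i)
      ≈⟨ +-cong (sum-cong-≋ {suc n} λ t → trans (*-congˡ (reflexive (≡.cong J (lemma (+ i) (+ n) (+ toℕ t)))))
            (reflexive (≡.cong term (≡.sym (toℕ-inject₁ t)))))
          (trans (*-congˡ (reflexive (≡.cong J (lemma′ (+ i) (+ suc n))))) (reflexive (≡.cong term (≡.sym (toℕ-fromℕ (suc n)))))) ⟩
    (∑[ t < suc n ] term (toℕ (inject₁ t))) + term (toℕ (fromℕ (suc n)))
      ≈⟨ sum-init-last {suc n} (term ∘ toℕ) ⟨
    (∑[ t < suc (suc n) ] term (toℕ t)) ∎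
    where
    term : ℕ → B
    term t = J⁻¹ (+ t) * J (+ i ℤ.+ (+ suc n ℤ.- + t))
    lemma : ∀ i n t → (1ℤ ℤ.+ i) ℤ.+ (n ℤ.- t) ≡ i ℤ.+ ((1ℤ ℤ.+ n) ℤ.- t)
    lemma = solve-∀
    lemma′ : ∀ i n → i ≡ i ℤ.+ (n ℤ.- n)
    lemma′ = solve-∀

  -- For n < 0 one of the indices t and n - t is always negative; for n ≥ 0 the nonzero terms lie in
  -- 0 ≤ t ≤ n, and their sum is the recursion that defines J(u)⁻¹.
  J⁻¹∗J : ∀ n → HasSumℤ (λ t → J⁻¹ t * J (n ℤ.- t)) (δ n 0ℤ)
  J⁻¹∗J -[1+ n ] = 0 , (λ where
      (+ t)    _ → trans (*-congˡ (J-negative (ℤ.≤-<-trans (ℤ.+-monoʳ-≤ -[1+ n ] (ℤ.neg-mono-≤ (ℤ.+≤+ {n = t} ℕ.z≤n))) ℤ.-<+))) (zeroʳ _)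
      -[1+ t ] _ → zeroˡ _) ,
    +-identityˡ 0#
  J⁻¹∗J (+ n) = suc n , (λ where
      (+ t)    n<t → trans (*-congˡ (J-negative (ℤ.<-≤-trans (ℤ.+-monoˡ-< (ℤ.- + t) (ℤ.+<+ n<t)) (ℤ.≤-reflexive (ℤ.+-inverseʳ (+ t)))))) (zeroʳ _)
      -[1+ t ] _   → zeroˡ _) ,
    trans (+-cong (trans (sum-cong-≋ {suc n} λ t → *-congˡ {x = J⁻¹ (+ toℕ t)} (reflexive (≡.cong J (≡.sym (ℤ.+-identityˡ (+ n ℤ.- + toℕ t))))))
                    (trans (sym (convolve-sum 0 n)) (value n)))
                  (∑-zero (suc n) λ t → zeroˡ (J (+ n ℤ.- -[1+ toℕ t ]))))
      (+-identityʳ _)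
    where
    value : ∀ n → let (x , xs) = inverseUpTo n in convolve 0 (x ∷ xs) ≈ δ (+ n) 0ℤ
    value zero    = trans (+-identityʳ _) (*-identityˡ 1#)
    value (suc n) = J∗J⁻¹-suc n

  module _ {D : ℤ → End B-module} (isD : IsUpperD D) where

    upper-value : ∀ α → IsPartition α → ∀ p →
      HasSumℕ (λ t → h⟨ p ⟩ (shiftedPart ⌜ α ⌝ t) * signedRemove α t) (D p ⟨$⟩ s ⌜ α ⌝)
    upper-value α α↘ p = HasSumℕ-cong (λ t → sym (sign-*ʳ t _ _)) refl (isD p α α↘)

    upper-zero : ∀ α → IsPartition α → ∀ r → D (+ r) ⟨$⟩ s ⌜ α ⌝ ≈ 0#
    upper-zero α α↘ r = HasSumℕ-unique (upper-value α α↘ (+ r)) (upper-vanishes α r)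

    DH-antisymmetrized : OpSeries
    DH-antisymmetrized = D[u] D ⊖ D[u] D [1/u]

    difference : ℤ → B → B
    difference k x = (D k ⟨$⟩ x) - (D (ℤ.- k) ⟨$⟩ x)

    DH-antisymmetrized-linear : ∀ k → IsLinear (DH-antisymmetrized k)
    DH-antisymmetrized-linear k = +-linear (extend-linear (D k)) (neg-linear (extend-linear (D (ℤ.- k))))

    DH-antisymmetrized-value : ∀ x k m → DH-antisymmetrized k (x z^ m) ≋ difference k x z^ m
    DH-antisymmetrized-value x k m n = trans
      (+-cong (z^-extend (D k) m x n) (trans (-‿cong (z^-extend (D (ℤ.- k)) m x n)) (z^-neg m (D (ℤ.- k) ⟨$⟩ x) n)))
      (sym (z^-+ m (D k ⟨$⟩ x) (- (D (ℤ.- k) ⟨$⟩ x)) n))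

    -- For k < 0 the term D^{(-k)} vanishes and h^{(k)} is already the shifted J. For k > 0 the sum
    -- for D^{(k)}, though zero, is kept, because h^{(k)} - h^{(-k)} is the single J with index
    -- raised by k. For k = 0 both sides vanish.
    difference-value : ∀ α → IsPartition α → ∀ k →
      HasSumℕ (λ t → J (shiftedPart ⌜ α ⌝ t ℤ.+ k) * signedRemove α t) (difference k (s ⌜ α ⌝))
    difference-value α α↘ (+ zero)  = HasSumℕ-cong (λ _ → refl) (sym (-‿inverseʳ _)) (upper-vanishes α 0)
    difference-value α α↘ -[1+ r ]  = HasSumℕ-cong (λ _ → refl)
      (sym (trans (+-congˡ (trans (-‿cong (upper-zero α α↘ (suc r))) -0#≈0#)) (+-identityʳ _)))
      (upper-value α α↘ -[1+ r ])
    difference-value α α↘ (+ suc r) = HasSumℕ-cong (λ t → cancel _ _ _) refl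
      (HasSumℕ-∙ (upper-value α α↘ (+ suc r)) (HasSumℕ-map (upper-value α α↘ -[1+ r ])))
      where
      open SumHomomorphism +-commutativeMonoid +-commutativeMonoid -_ -‿cong -0#≈0# (λ x y → sym (-‿+-comm x y))
      cancel : ∀ a b x → (a + b) * x - b * x ≈ a * x
      cancel a b x = trans (+-congʳ (distribʳ _ _ _)) (trans (+-assoc _ _ _)
        (trans (+-congˡ (-‿inverseʳ _)) (+-identityʳ _)))

    annihilation : ∀ {ψ*} → IsAnnihilation ψ* → ∀ m →
      Ψ*[u] ψ* ≐ (u^ ℤ.- m ℤ.+ 1ℤ z^ -1ℤ · J⁻¹[u]) ∗ DH-antisymmetrized on-z^ m B
    annihilation {ψ*} isψ* m k = HasSum-extend {T} {ψ* (ℤ.- k) ⟨$⟩_}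
      (λ t → z^-linear -1ℤ (•-linear (J⁻¹ (t ℤ.- a)) (DH-antisymmetrized-linear (k ℤ.- t)))) (End-linear (ψ* (ℤ.- k))) m on-basis
      where
      a = ℤ.- m ℤ.+ 1ℤ
      T : ℤ → 𝓑 → 𝓑
      T t v = z^ -1ℤ · (J⁻¹ (t ℤ.- a) • DH-antisymmetrized (k ℤ.- t) v)
      module _ (α : List ℕ) (α↘ : IsPartition α) where
        -- One number of rows for all exponents t: whenever J⁻¹ (t - a) ≠ 0, t ≥ a and hence k - t ≤
        -- k - a ≤ ∣ k - a ∣.
        N = length α ℕ.+ suc (suc ∣ k ℤ.- a ∣)
        x = shiftedPart ⌜ α ⌝
        f : ℤ → B
        f t = J⁻¹ (t ℤ.- a) * difference (k ℤ.- t) (s ⌜ α ⌝)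
        limit : B
        limit = ∑[ i < N ] (δ (x (toℕ i) ℤ.+ k ℤ.- a) 0ℤ * signedRemove α (toℕ i))

        i≤∣i∣ : ∀ i → i ℤ.≤ + ∣ i ∣
        i≤∣i∣ (+ n)    = ℤ.≤-refl
        i≤∣i∣ -[1+ n ] = ℤ.-≤+

        below : ∀ {i} → N ℕ.≤ i → ∀ {j} → j ℤ.≤ k ℤ.- a → x i ℤ.+ j ℤ.< 0ℤ
        below {i} N≤i j≤ = ℤ.≤-<-trans (ℤ.+-monoʳ-≤ (x i) (ℤ.≤-trans j≤ (i≤∣i∣ (k ℤ.- a))))
          (shiftedPart-negative α ∣ k ℤ.- a ∣ N≤i)

        f-value : ∀ t → (∑[ i < N ] (J⁻¹ (t ℤ.- a) * J (x (toℕ i) ℤ.+ k ℤ.- a ℤ.- (t ℤ.- a)) * signedRemove α (toℕ i))) ≈ f t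
        f-value t = trans (sum-cong-≋ {N} λ i → trans (*-assoc _ _ _) (*-congˡ (*-congʳ (reflexive (≡.cong J (lemma (x (toℕ i)) k a t))))))
          (trans (sym (*-distribˡ-sum {N} (J⁻¹ (t ℤ.- a)) (λ i → J (x (toℕ i) ℤ.+ (k ℤ.- t)) * signedRemove α (toℕ i))))
            (go (t ℤ.- a) (≡.sym (lemma′ k a t))))
          where
          lemma : ∀ x k a t → x ℤ.+ k ℤ.- a ℤ.- (t ℤ.- a) ≡ x ℤ.+ (k ℤ.- t)
          lemma = solve-∀
          lemma′ : ∀ k a t → k ℤ.- t ℤ.+ (t ℤ.- a) ≡ k ℤ.- a
          lemma′ = solve-∀
          go : ∀ i → k ℤ.- a ≡ k ℤ.- t ℤ.+ i →
               J⁻¹ i * (∑[ i < N ] (J (x (toℕ i) ℤ.+ (k ℤ.- t)) * signedRemove α (toℕ i)))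
                 ≈ J⁻¹ i * difference (k ℤ.- t) (s ⌜ α ⌝)
          -- For t < a the rows beyond `N` may contribute to the inner sum, but the coefficient of
          -- J(u)⁻¹ is zero.
          go -[1+ i ] eq = trans (zeroˡ _) (sym (zeroˡ _))
          go (+ i)    eq = *-congˡ (HasSumℕ-value (difference-value α α↘ (k ℤ.- t)) N λ j N≤j →
            trans (*-congʳ (J-negative (below N≤j (i≤j-from-difference i eq)))) (zeroˡ _))

        -- With the number of rows fixed the sums are exchanged: for each row the sum over t is the
        -- coefficient of u^{x_i+k-a} in J(u)⁻¹ J(u) = 1.
        f-sum : HasSumℤ f limit
        f-sum = HasSumℤ-cong f-value refl (HasSumℤ-∑ N λ i →
          SumHomomorphism.HasSumℤ-map +-commutativeMonoid +-commutativeMonoid (_* signedRemove α (toℕ i))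
            *-congʳ (zeroˡ _) (λ _ _ → distribʳ _ _ _)
            (HasSumℤ-shift (ℤ.- a) (J⁻¹∗J (x (toℕ i) ℤ.+ k ℤ.- a))))

        summand : ℕ → B
        summand i = [-1]^ i · (δ (ℤ.- k ℤ.- m ℤ.- 1ℤ) (part ⌜ α ⌝ i ℤ.- + suc i) * s (remove i ⌜ α ⌝))

        δ-shift : ∀ i → δ (ℤ.- k ℤ.- m ℤ.- 1ℤ) (part ⌜ α ⌝ i ℤ.- + suc i) ≡ δ (x i ℤ.+ k ℤ.- a) 0ℤ
        δ-shift i = ≡.cong (if_then 1# else 0#) (does-⇔ (mk⇔ to from)
          (ℤ.- k ℤ.- m ℤ.- 1ℤ ℤ.≟ part ⌜ α ⌝ i ℤ.- + suc i) (x i ℤ.+ k ℤ.- a ℤ.≟ 0ℤ))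
          where
          lemma : ∀ p i k m → p ℤ.- i ℤ.+ 1ℤ ℤ.+ k ℤ.- (ℤ.- m ℤ.+ 1ℤ) ≡ p ℤ.- (1ℤ ℤ.+ i) ℤ.- (ℤ.- k ℤ.- m ℤ.- 1ℤ)
          lemma = solve-∀
          eq : x i ℤ.+ k ℤ.- a ≡ part ⌜ α ⌝ i ℤ.- + suc i ℤ.- (ℤ.- k ℤ.- m ℤ.- 1ℤ)
          eq = lemma (part ⌜ α ⌝ i) (+ i) k m
          to : ℤ.- k ℤ.- m ℤ.- 1ℤ ≡ part ⌜ α ⌝ i ℤ.- + suc i → x i ℤ.+ k ℤ.- a ≡ 0ℤ
          to p = ≡.trans eq (ℤ.i≡j⇒i-j≡0 (≡.sym p))
          from : x i ℤ.+ k ℤ.- a ≡ 0ℤ → ℤ.- k ℤ.- m ℤ.- 1ℤ ≡ part ⌜ α ⌝ i ℤ.- + suc i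
          from p = ≡.sym (ℤ.i-j≡0⇒i≡j (part ⌜ α ⌝ i ℤ.- + suc i) (ℤ.- k ℤ.- m ℤ.- 1ℤ) (≡.trans (≡.sym eq) p))

        summand-value : ∀ i → summand i ≈ δ (x i ℤ.+ k ℤ.- a) 0ℤ * signedRemove α i
        summand-value i = trans (sym (sign-*ʳ i _ _)) (*-congʳ (reflexive (δ-shift i)))

        δ-nonzero : ∀ {i} → i ℤ.< 0ℤ → δ i 0ℤ ≡ 0#
        δ-nonzero ℤ.-<+ = ≡.refl

        summand-vanishes : ∀ i → N ℕ.≤ i → summand i z^ (m ℤ.- 1ℤ) ≋ M.0ᴹ
        summand-vanishes i N≤i n = trans (z^-cong (m ℤ.- 1ℤ) (trans (summand-value i)
            (trans (*-congʳ (reflexive (δ-nonzero (≡.subst (ℤ._< 0ℤ) (≡.sym (ℤ.+-assoc (x i) k (ℤ.- a))) (below N≤i ℤ.≤-refl)))))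
              (zeroˡ _))) n)
          (z^-0 (m ℤ.- 1ℤ) n)

        limit-value : limit z^ (m ℤ.- 1ℤ) ≋ ψ* (ℤ.- k) ⟨$⟩ (s ⌜ α ⌝ z^ m)
        limit-value n = trans (z^-cong (m ℤ.- 1ℤ) (sum-cong-≋ {N} λ i → sym (summand-value (toℕ i))) n)
          (trans (z^-Sum.∑-map (m ℤ.- 1ℤ) {N} (summand ∘ toℕ) n)
            (M.HasSumℕ-value {λ i → summand i z^ (m ℤ.- 1ℤ)} {ψ* (ℤ.- k) ⟨$⟩ (s ⌜ α ⌝ z^ m)}
              (isψ* (ℤ.- k) m α α↘) N summand-vanishes n))

        term : ∀ t → f t z^ (m ℤ.- 1ℤ) ≋ T t (s ⌜ α ⌝ z^ m)
        term t i = begin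
          coeff (f t z^ (m ℤ.- 1ℤ)) i
            ≈⟨ z^-shift -1ℤ m (f t) i ⟨
          coeff (f t z^ m) (i ℤ.- -1ℤ)
            ≈⟨ z^-• (J⁻¹ (t ℤ.- a)) m (difference (k ℤ.- t) (s ⌜ α ⌝)) (i ℤ.- -1ℤ) ⟨
          J⁻¹ (t ℤ.- a) * coeff (difference (k ℤ.- t) (s ⌜ α ⌝) z^ m) (i ℤ.- -1ℤ)
            ≈⟨ *-congˡ (DH-antisymmetrized-value (s ⌜ α ⌝) (k ℤ.- t) m (i ℤ.- -1ℤ)) ⟨
          coeff (T t (s ⌜ α ⌝ z^ m)) i ∎

        on-basis : M.HasSumℤ (λ t → T t (s ⌜ α ⌝ z^ m)) (ψ* (ℤ.- k) ⟨$⟩ (s ⌜ α ⌝ z^ m))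
        on-basis = M.HasSumℤ-cong
          {f = λ t → f t z^ (m ℤ.- 1ℤ)} {g = λ t → T t (s ⌜ α ⌝ z^ m)}
          {x = limit z^ (m ℤ.- 1ℤ)} {y = ψ* (ℤ.- k) ⟨$⟩ (s ⌜ α ⌝ z^ m)}
          term limit-value (z^-Sum.HasSumℤ-map (m ℤ.- 1ℤ) f-sum)

proposition5p2 :
  ∀ {c ℓ} (K : CommutativeRing c ℓ) (𝔤 : LieType) →
  let open FockSpace K 𝔤 in
  (ψ ψ* : ℤ → End 𝓑-module) (D Dᵘ : ℤ → End B-module) →
  IsCreation ψ → IsAnnihilation ψ* → IsLowerD D → IsUpperD Dᵘ →
  let DE = D[u] D
      DH = D[u] Dᵘ in
  ∀ (m : ℤ) →
    (Ψ[u] ψ ≐ (u^ m ℤ.+ 1ℤ z^ 1ℤ · J[u])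
            ∗ (DE [-u] ⊕ DE [-u] [1/u] ⊖ constant (extend (D 0ℤ))) on-z^ m B)
    ×
    (Ψ*[u] ψ* ≐ (u^ ℤ.- m ℤ.+ 1ℤ z^ -1ℤ · J⁻¹[u])
              ∗ (DH ⊖ DH [1/u]) on-z^ m B)
proposition5p2 K 𝔤 ψ ψ* D Dᵘ isψ isψ* isD isDᵘ m =
  creation {D} isD {ψ} isψ m , annihilation {Dᵘ} isDᵘ {ψ*} isψ* m
  where open FockSpaceProperties K 𝔤
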